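{- Let $n\ge 1$ and let $\mathcal{A}$ be a union-closed (UC) family with $U(\mathcal{A})=[n]$ and $\emptyset\in\mathcal{A}$. Then the algorithm "Cutting planes for FC-families" described in the context, run on input $\mathcal{A}$, correctly determines whether $\mathcal{A}$ is an FC-family or a Non-FC-family; that is, for every admissible sequence of choices it makes, it stops after finitely many iterations, and it returns "$\mathcal{A}$ is an FC-family" if $\mathcal{A}$ is an FC-family and "$\mathcal{A}$ is a Non-FC-family" if $\mathcal{A}$ is a Non-FC-family.
   Context: Families: A UC (union-closed) family is a nonempty finite family $\mathcal{F}$ of distinct finite sets such that $A\cup B\in\mathcal{F}$ for all $A,B\in\mathcal{F}$. $[n]=\{1,\dots,n\}$, $\mathcal{P}([n])$ is its power set, $U(\mathcal{F})$ is the union of all sets in $\mathcal{F}$, $\mathcal{F}_i=\{F\in\mathcal{F} : i\in F\}$, and $\mathcal{A}\uplus\mathcal{B}=\{A\cup B : A\in\mathcal{A},B\in\mathcal{B}\}$. A UC family $\mathcal{A}$, whose largest set is $U(\mathcal{A})$, is an FC-family (Frankl-Complete) iff for every UC family $\mathcal{F}\supseteq\mathcal{A}$ there is $i\in U(\mathcal{A})$ with $|\mathcal{F}_i|\ge|\mathcal{F}|/2$; it is a Non-FC-family iff there is a UC family $\mathcal{F}\supseteq\mathcal{A}$ such that $|\mathcal{F}_i|<|\mathcal{F}|/2$ for every $i\in U(\mathcal{A})$. The set $X(\mathcal{A},c)$: for $c\in\mathbb{Z}_{\ge0}^n$ with $\sum_{i\in[n]}c_i\ge1$, $X(\mathcal{A},c)$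 is the set of integer vectors $x=(x_S)_{S\in\mathcal{P}([n])}\in\mathbb{R}^{2^n}$ satisfying (UC) $x_S+x_T\le 1+x_{S\cup T}$ for all $S,T\in\mathcal{P}([n])$; (WV) $\sum_{S\in\mathcal{P}([n])}\left(\sum_{i\in S}c_i-\sum_{i\notin S}c_i\right)x_S+1\le 0$; (FS) $x_S\le x_{A\cup S}$ for all $S\in\mathcal{P}([n])$, $A\in\mathcal{A}$; and $0\le x_S\le 1$ for all $S\in\mathcal{P}([n])$. For $\mathcal{B}\subseteq\mathcal{P}([n])$, $\mathcal{X}^{\mathcal{B}}\in\mathbb{R}^{2^n}$ denotes its incidence vector ($\mathcal{X}^{\mathcal{B}}_S=1$ if $S\in\mathcal{B}$, and $0$ otherwise); every element of $X(\mathcal{A},c)$ is of the form $\mathcal{X}^{\mathcal{B}}$ for a unique $\mathcal{B}$. Algorithm "Cutting planes for FC-families". Input: a UC family $\mathcal{A}$ with $U(\mathcal{A})=[n]$, $\emptyset\in\mathcal{A}$. 1. Let $H\leftarrow\{y\in\mathbb{R}^n : \sum_{i\in[n]}y_i=1,\ y_i\ge0\ \forall i\in[n]\}$. 2. While there exists a rational vector in $H$, pick one such vector $\bar y=(a_1/b_1,\dots,a_n/b_n)\in\mathbb{Q}_{\ge0}^n$ with integers $b_i\ge1$; set $g\leftarrow\mathrm{lcm}(b_1,\dots,b_n)$ and $c\leftarrow g\bar y$. If $X(\mathcal{A},c)\neq\emptyset$, pick some $\mathcal{X}^{\mathcal{B}}\in X(\mathcal{A},c)$ and replace $H$ by $H\cap\{y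 : \sum_{i\in[n]}y_i|\mathcal{B}_i|\ge|\mathcal{B}|/2\}$; otherwise stop and return "$\mathcal{A}$ is an FC-family". 3. When the while-loop ends (i.e. $H$ contains no rational vector), return "$\mathcal{A}$ is a Non-FC-family". -}

module Defs where

open import Algebra.Definitions.RawMonoid using (sum)
open import Data.Bool.Base using (Bool; T; _∧_; if_then_else_)
open import Data.Fin.Base using (Fin; _↑ˡ_)
open import Data.Fin.Subset using (Subset; inside; outside; _∈_; _∪_; ∁; ⊥)
open import Data.Fin.Subset.Properties using (_∈?_)
open import Data.Integer.Base as ℤ using (ℤ; +_; 0ℤ; 1ℤ)
open import Data.List.Base as List using (List; filterᵇ; length)
open import Data.Nat.Base as ℕ using (ℕ; zero; suc)
open import Data.Nat.LCM using (lcm)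
open import Data.Product.Base using (∃; _×_)
open import Data.Rational.Unnormalised.Base as ℚ using (ℚᵘ; 0ℚᵘ; 1ℚᵘ; ↥_; ↧ₙ_)
open import Data.Vec.Base as Vec using ([]; _∷_)
open import Data.Vec.Functional using (Vector; foldr)
open import Level using (0ℓ)
open import Relation.Binary.Construct.Closure.ReflexiveTransitive using (Star)
open import Relation.Nullary.Decidable.Core using (does)
open import Relation.Unary as Unary using (Pred)

------------------------------------------------------------------------
-- Families of finite sets

-- A finite family of distinct subsets of [n], given by its
-- characteristic function on 𝒫([n]); [n] is represented by Fin n.
Family : ℕ → Set
Family n = Subset n → Bool

subsets : ∀ n → List (Subset n)
subsets zero    = [] List.∷ List.[]
subsets (suc n) = List.map (outside ∷_) (subsets n) List.++
                  List.map (inside ∷_) (subsets n)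

infix 4 _∈F_ _∈U_

_∈F_ : ∀ {n} → Subset n → Family n → Set
S ∈F 𝓕 = T (𝓕 S)

_∈U_ : ∀ {n} → Fin n → Family n → Set
i ∈U 𝓕 = ∃ λ S → S ∈F 𝓕 × i ∈ S

∣_∣F : ∀ {n} → Family n → ℕ
∣ 𝓕 ∣F = length (filterᵇ 𝓕 (subsets _))

-- 𝓕 at i is the subfamily 𝓕ᵢ = {F ∈ 𝓕 : i ∈ F}.
_at_ : ∀ {n} → Family n → Fin n → Family n
(𝓕 at i) S = 𝓕 S ∧ does (i ∈? S)

record UnionClosed {n} (𝓕 : Family n) : Set where
  field
    nonempty : ∃ λ S → S ∈F 𝓕
    closed   : ∀ S S′ → S ∈F 𝓕 → S′ ∈F 𝓕 → (S ∪ S′) ∈F 𝓕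

-- 𝓐 ⊆ 𝓕, for 𝓐 a family on [n] and 𝓕 a family on [n + m] ⊇ [n]: the
-- copy of S ⊆ [n] inside [n + m] is S padded with m outsides.
_⊑_ : ∀ {n m} → Family n → Family (n ℕ.+ m) → Set
_⊑_ {m = m} 𝓐 𝓕 = ∀ S → S ∈F 𝓐 → (S Vec.++ ⊥ {m}) ∈F 𝓕

-- A finite family of finite sets of positive integers containing a
-- family on [n] is a family on [n + m] for some m, so 𝓕 below ranges
-- over all finite families.  |𝓕ᵢ| ≥ |𝓕|/2 is multiplied out by 2.
IsFC : ∀ {n} → Family n → Set
IsFC {n} 𝓐 =
  ∀ m (𝓕 : Family (n ℕ.+ m)) → UnionClosed 𝓕 → 𝓐 ⊑ 𝓕 →
  ∃ λ i → i ∈U 𝓐 × ∣ 𝓕 ∣F ℕ.≤ 2 ℕ.* ∣ 𝓕 at (i ↑ˡ m) ∣F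

IsNonFC : ∀ {n} → Family n → Set
IsNonFC {n} 𝓐 =
  ∃ λ m → ∃ λ (𝓕 : Family (n ℕ.+ m)) → UnionClosed 𝓕 × 𝓐 ⊑ 𝓕 ×
  (∀ i → i ∈U 𝓐 → 2 ℕ.* ∣ 𝓕 at (i ↑ˡ m) ∣F ℕ.< ∣ 𝓕 ∣F)

------------------------------------------------------------------------
-- The set X(𝓐,c)

-- Σ_{i ∈ S} cᵢ
weight : ∀ {n} → Vector ℕ n → Subset n → ℕ
weight c S = sum ℕ.+-0-rawMonoid λ i → if does (i ∈? S) then c i else 0

sumℤ : List ℤ → ℤ
sumℤ = List.foldr ℤ._+_ 0ℤ

record X {n} (𝓐 : Family n) (c : Vector ℕ n) (x : Subset n → ℤ) : Set where
  field
    UC    : ∀ S S′ → x S ℤ.+ x S′ ℤ.≤ 1ℤ ℤ.+ x (S ∪ S′)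
    WV    : sumℤ (List.map (λ S → (+ weight c S ℤ.- + weight c (∁ S)) ℤ.* x S)
                           (subsets n))
            ℤ.+ 1ℤ ℤ.≤ 0ℤ
    FS    : ∀ S A → A ∈F 𝓐 → x S ℤ.≤ x (A ∪ S)
    lower : ∀ S → 0ℤ ℤ.≤ x S
    upper : ∀ S → x S ℤ.≤ 1ℤ

incidence : ∀ {n} → Family n → Subset n → ℤ
incidence 𝓑 S = if 𝓑 S then 1ℤ else 0ℤ

------------------------------------------------------------------------
-- The algorithm

sumℚ : ∀ {n} → Vector ℚᵘ n → ℚᵘ
sumℚ = sum ℚ.+-0-rawMonoid

-- A polyhedron H ⊆ ℝⁿ, represented by its set of rational points: the
-- algorithm inspects H only through these.  Unnormalised rationals
-- keep the numerators aᵢ and the denominators bᵢ ≥ 1 of a chosen point,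
-- on which g and c depend.
RationalPoints : ℕ → Set₁
RationalPoints n = Pred (Vector ℚᵘ n) 0ℓ

simplex : ∀ {n} → RationalPoints n
simplex y = sumℚ y ℚ.≃ 1ℚᵘ × (∀ i → 0ℚᵘ ℚ.≤ y i)

-- Σᵢ yᵢ |𝓑ᵢ| ≥ |𝓑|/2
halfspace : ∀ {n} → Family n → RationalPoints n
halfspace 𝓑 y =
  (+ ∣ 𝓑 ∣F) ℚ./ 2 ℚ.≤ sumℚ (λ i → y i ℚ.* ((+ ∣ 𝓑 at i ∣F) ℚ./ 1))

commonDenominator : ∀ {n} → Vector ℚᵘ n → ℕ
commonDenominator y = foldr lcm 1 (λ i → ↧ₙ (y i))

-- c = g ȳ for ȳ ≥ 0, computed as cᵢ = aᵢ · (g / bᵢ), where bᵢ ∣ g.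
scaled : ∀ {n} → Vector ℚᵘ n → Vector ℕ n
scaled y i = ℤ.∣ ↥ (y i) ∣ ℕ.* (commonDenominator y ℕ./ ↧ₙ (y i))

data Verdict : Set where
  FC NonFC : Verdict

module CuttingPlanes {n} (𝓐 : Family n) where

  data State : Set₁ where
    loop     : (H : RationalPoints n) → State
    picked   : (H : RationalPoints n) (ȳ : Vector ℚᵘ n) → State
    returned : Verdict → State

  start : State
  start = loop simplex

  infix 4 _⟶_ _⟶*_

  -- Nondeterministic: a run is a sequence of admissible choices.
  data _⟶_ : State → State → Set₁ where
    pick      : ∀ {H ȳ} → H ȳ → loop H ⟶ picked H ȳ
    cut       : ∀ {H ȳ} 𝓑 → X 𝓐 (scaled ȳ) (incidence 𝓑) →
                picked H ȳ ⟶ loop (H Unary.∩ halfspace 𝓑)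
    stop      : ∀ {H ȳ} → Unary.Empty (X 𝓐 (scaled ȳ)) →
                picked H ȳ ⟶ returned FC
    exhausted : ∀ {H} → Unary.Empty H → loop H ⟶ returned NonFC

  _⟶*_ : State → State → Set₁
  _⟶*_ = Star _⟶_

{-# OPTIONS --safe #-}

-- Write d(𝓑)ᵢ = 2|𝓑ᵢ| − |𝓑| for the excess of 𝓑 at i.  For y in the simplex and
-- c = g y, the constraint (WV) on 𝓑 says c · d(𝓑) < 0 and the cut of 𝓑 says
-- c · d(𝓑) ≥ 0, so a picked point violates the cut it produces; no family is
-- used twice, and the algorithm stops.
--
-- If X(𝓐,c) is empty and 𝓕 ⊇ 𝓐 is a union-closed family on [n + m] with
-- d(𝓕)ᵢ < 0 for all i ∈ [n], then c · d(𝓕) is the sum over t ⊆ [m] of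
-- c · d(𝓕ₜ), where 𝓕ₜ is the family of the traces on [n] of the members with
-- trace t on [m].  Some summand is negative, and that 𝓕ₜ lies in X(𝓐,c).
--
-- If the polyhedron of the cuts 𝓑₁, …, 𝓑ₖ has no rational point, Ville's theorem
-- of the alternative gives lⱼ ∈ ℕ with Σⱼ lⱼ d(𝓑ⱼ)ᵢ < 0 for all i.  Sufficiently
-- many copies of the 𝓑ⱼ, placed over the coatoms of a Boolean lattice, together
-- with 𝒫([n]) over its top and 𝓐 below everything, form a union-closed family
-- that shows 𝓐 to be a Non-FC-family.  Ville's theorem is proved by Farkas'
-- lemma over ℤ, by induction on the number of functionals, and this makes the
-- emptiness of the polyhedron decidable.
module Submission where

open import Defs
import Algebra.Properties.Monoid.Sum as Monoid-sum
open import Data.Bool.Base using (Bool; true; false; T; not; _∧_; if_then_else_)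
open import Data.Bool.Properties using (T?; T-∧)
open import Data.Fin.Base as Fin using (Fin; zero; suc; _↑ˡ_; _↑ʳ_; combine; remQuot)
open import Data.Fin.Properties as Fin using (any?; remQuot-combine)
open import Data.Fin.Subset as Subset using (Subset; inside; outside; _∈_; _∉_; _⊂_; _∪_; ∁; ⊥; ⊤)
open import Data.Fin.Subset.Induction using (⊂-wellFounded)
open import Data.Fin.Subset.Properties
  using (_∈?_; anySubset?; ∪-identityˡ; ∪-comm; ∪-idem; ∈⊤; x∈p⇒p-x⊂p; x∈p∧x≢y⇒x∈p-y)
open import Data.Integer.Base hiding (suc; _/_)
open import Data.Integer.Properties as ℤ hiding (_≟_)
open import Data.Integer.Tactic.RingSolver using (solve-∀)
open import Data.List.Base as List using (List; filterᵇ; length; replicate)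
open import Data.List.Properties using (map-++; map-∘; map-cong)
open import Data.List.Relation.Unary.All as All using (All)
open import Data.List.Relation.Unary.All.Properties using (++⁺; replicate⁺)
open import Data.Nat.Base as ℕ using (ℕ; zero; suc)
open import Data.Nat.DivMod using (m/n*n≡m)
open import Data.Nat.Divisibility using (_∣_; ∣-trans)
open import Data.Nat.GCD using (gcd)
open import Data.Nat.LCM using (lcm; m∣lcm[m,n]; n∣lcm[m,n]; gcd*lcm)
import Data.Nat.Properties as ℕ
open import Data.Product.Base using (∃; ∃₂; _×_; _,_; proj₁; proj₂)
open import Data.Rational.Unnormalised.Base as ℚ using (ℚᵘ; mkℚᵘ; 0ℚᵘ; ↥_; ↧_; ↧ₙ_; *≤*; *≡*)
open import Data.Sum.Base using (_⊎_; inj₁; inj₂)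
open import Data.Vec.Base as Vec using ([]; _∷_)
open import Data.Vec.Functional as Vector using (Vector)
open import Data.Vec.Functional.Properties using (lookup-++ˡ; lookup-++ʳ)
open import Data.Vec.Properties using (zipWith-++)
open import Function.Base using (_∘_; flip)
open import Function.Bundles using (_⇔_; mk⇔; Equivalence)
open import Induction.WellFounded using (Acc; acc)
open import Relation.Binary.Construct.Closure.ReflexiveTransitive using (ε; _◅_)
open import Relation.Binary.PropositionalEquality
open import Relation.Nullary.Decidable.Core
  using (Dec; yes; no; does; map′; ¬?; _×-dec_; _→-dec_; decidable-stable)
open import Relation.Nullary.Negation.Core using (¬_; contradiction)
open import Relation.Unary using (Decidable)
open import Algebra.Properties.Semiring.Sum +-*-semiring
  using (sum; sum-cong-≗; ∑-distrib-+; *-distribˡ-sum; ∑-comm; sum-replicate-zero)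

private module ℕ-sum = Monoid-sum ℕ.+-0-monoid

-- Farkas' lemma and Ville's theorem of the alternative over ℤ

*-nonNeg : ∀ {i j} → 0ℤ ≤ i → 0ℤ ≤ j → 0ℤ ≤ i * j
*-nonNeg {+ m} {+ n} _ _ = subst (0ℤ ≤_) (pos-* m n) (+≤+ ℕ.z≤n)

*-pos : ∀ {i j} → 0ℤ < i → 0ℤ < j → 0ℤ < i * j
*-pos {+[1+ m ]} {+[1+ n ]} _ _ = +<+ ℕ.z<s
*-pos {+0} (+<+ ()) _
*-pos {+[1+ m ]} {+0} _ (+<+ ())

square-nonNeg : ∀ i → 0ℤ ≤ i * i
square-nonNeg (+ n)    = *-nonNeg {+ n} (+≤+ ℕ.z≤n) (+≤+ ℕ.z≤n)
square-nonNeg -[1+ n ] = +≤+ ℕ.z≤n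

opaque
  ∑ : ∀ {n} → Vector ℤ n → ℤ
  ∑ = sum

  ∑-[] : (f : Vector ℤ 0) → ∑ f ≡ 0ℤ
  ∑-[] f = refl

  ∑-suc : ∀ {n} (f : Vector ℤ (suc n)) → ∑ f ≡ f zero + ∑ (f ∘ suc)
  ∑-suc f = refl

  ∑-zero : ∀ {n} → ∑ {n} (λ _ → 0ℤ) ≡ 0ℤ
  ∑-zero {n} = sum-replicate-zero n

  ∑-cong : ∀ {n} {f g : Vector ℤ n} → (∀ i → f i ≡ g i) → ∑ f ≡ ∑ g
  ∑-cong {f = f} {g} = sum-cong-≗ {x = f} {g}

  ∑-lin : ∀ {n} p q (f g : Vector ℤ n) → ∑ (λ i → p * f i + q * g i) ≡ p * ∑ f + q * ∑ g
  ∑-lin p q f g = trans (∑-distrib-+ (λ i → p * f i) (λ i → q * g i))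
    (cong₂ _+_ (sym (*-distribˡ-sum p f)) (sym (*-distribˡ-sum q g)))

  ∑-swap : ∀ {m n} (f : Fin m → Fin n → ℤ) → ∑ (λ i → ∑ (f i)) ≡ ∑ (λ j → ∑ (λ i → f i j))
  ∑-swap = ∑-comm

  ∑-*ˡ : ∀ {n} p (f : Vector ℤ n) → p * ∑ f ≡ ∑ (λ i → p * f i)
  ∑-*ˡ = *-distribˡ-sum

  ∑-mono : ∀ {n} {f g : Vector ℤ n} → (∀ i → f i ≤ g i) → ∑ f ≤ ∑ g
  ∑-mono {zero}  _   = ≤-refl
  ∑-mono {suc n} f≤g = +-mono-≤ (f≤g zero) (∑-mono (λ i → f≤g (suc i)))

  ∑-++ : ∀ {m n} (f : Vector ℤ (m ℕ.+ n)) →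
    ∑ f ≡ ∑ (λ i → f (i ↑ˡ n)) + ∑ (λ j → f (m ↑ʳ j))
  ∑-++ {zero}      f = sym (+-identityˡ (∑ f))
  ∑-++ {suc m} {n} f = trans (cong (λ s → f zero + s) (∑-++ {m} (λ i → f (suc i))))
    (sym (+-assoc (f zero) (∑ (λ i → f (suc (i ↑ˡ n)))) (∑ (λ j → f (suc (m ↑ʳ j))))))

∑-nonNeg : ∀ {n} {f : Vector ℤ n} → (∀ i → 0ℤ ≤ f i) → 0ℤ ≤ ∑ f
∑-nonNeg {n} {f} f≥0 = subst (λ z → z ≤ ∑ f) (∑-zero {n}) (∑-mono f≥0)

term≤∑ : ∀ {n} {f : Vector ℤ n} → (∀ i → 0ℤ ≤ f i) → ∀ i → f i ≤ ∑ f
term≤∑ {f = f} f≥0 zero    = subst₂ _≤_ (+-identityʳ (f zero)) (sym (∑-suc f))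
  (+-monoʳ-≤ (f zero) (∑-nonNeg (λ i → f≥0 (suc i))))
term≤∑ {f = f} f≥0 (suc i) = subst₂ _≤_ (+-identityˡ (f (suc i))) (sym (∑-suc f))
  (+-mono-≤ (f≥0 zero) (term≤∑ (λ i → f≥0 (suc i)) i))

infix 8 _·_
_·_ : ∀ {n} → Vector ℤ n → Vector ℤ n → ℤ
u · v = ∑ (λ i → u i * v i)

lin : ∀ {n} → ℤ → Vector ℤ n → ℤ → Vector ℤ n → Vector ℤ n
lin p u q v i = p * u i + q * v i

lin-· : ∀ {n} p (u : Vector ℤ n) q v w → lin p u q v · w ≡ p * u · w + q * v · w
lin-· p u q v w = trans (∑-cong (λ i → distrib p q (u i) (v i) (w i))) (∑-lin p q (λ i → u i * w i) (λ i → v i * w i))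
  where
  distrib : ∀ p q x y z → (p * x + q * y) * z ≡ p * (x * z) + q * (y * z)
  distrib = solve-∀

·-lin : ∀ {n} w p (u : Vector ℤ n) q v → w · lin p u q v ≡ p * w · u + q * w · v
·-lin w p u q v = trans (∑-cong (λ i → distrib p q (u i) (v i) (w i))) (∑-lin p q (λ i → w i * u i) (λ i → w i * v i))
  where
  distrib : ∀ p q x y z → z * (p * x + q * y) ≡ p * (z * x) + q * (z * y)
  distrib = solve-∀

Separated : ∀ {m k} → Vector (Vector ℤ k) m → Vector ℤ k → Set
Separated {k = k} a c = ∃ λ (x : Vector ℤ k) → (∀ i → a i · x ≤ 0ℤ) × 0ℤ < c · x

-- Membership of `c` in the rational cone spanned by the `a i`, cleared of denominators: `γ` is a
-- common denominator of the coefficients.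
Generated : ∀ {m k} → Vector (Vector ℤ k) m → Vector ℤ k → Set
Generated {m} a c = ∃₂ λ (γ : ℤ) (l : Vector ℤ m) → 0ℤ < γ × (∀ i → 0ℤ ≤ l i) ×
  ∀ j → γ * c j ≡ ∑ (λ i → l i * a i j)

-- A separating `x` for all functionals but the first either satisfies the first one, `a₀`, as well,
-- or has `a₀ · x > 0`. In the latter case the other functionals and `c` are projected along `a₀`,
-- and the projected problem has one functional fewer.
farkas : ∀ {m k} (a : Vector (Vector ℤ k) m) c → Separated a c ⊎ Generated a c
-- Without functionals, `c` separates itself unless it vanishes, and then it is the empty
-- combination.
farkas {zero} a c with 0ℤ <? c · c
... | yes c·c>0 = inj₁ (c , (λ ()) , c·c>0)
... | no  c·c≯0 = inj₂ (1ℤ , (λ _ → 0ℤ) , +<+ ℕ.z<s , (λ ()) ,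
  λ j → trans (*-identityˡ (c j)) (trans (c≡0 j) (sym (∑-[] (λ i → 0ℤ * a i j)))))
  where
  c≡0 : ∀ j → c j ≡ 0ℤ
  c≡0 j with i*j≡0⇒i≡0∨j≡0 (c j) (≤-antisym
    (≤-trans (term≤∑ (λ i → square-nonNeg (c i)) j) (≮⇒≥ c·c≯0)) (square-nonNeg (c j)))
  ... | inj₁ eq = eq
  ... | inj₂ eq = eq
farkas {suc m} a c with farkas (a ∘ suc) c
... | inj₂ (γ , l , γ>0 , l≥0 , eq) = inj₂ (γ , 0ℤ Vector.∷ l , γ>0 ,
  (λ { zero → ≤-refl ; (suc i) → l≥0 i }) ,
  λ j → trans (eq j) (sym (trans (∑-suc (λ i → (0ℤ Vector.∷ l) i * a i j))
    (trans (cong (λ z → z + ∑ (λ i → l i * a (suc i) j)) (*-zeroˡ (a zero j)))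
      (+-identityˡ (∑ (λ i → l i * a (suc i) j)))))))
... | inj₁ (x , ax≤0 , cx>0) with a zero · x ≤? 0ℤ
...   | yes a₀x≤0 = inj₁ (x , (λ { zero → a₀x≤0 ; (suc i) → ax≤0 i }) , cx>0)
...   | no  a₀x≰0 = project (farkas (proj ∘ a ∘ suc) (proj c))
  where
  a₀ = a zero
  α  = a₀ · x
  α>0 : 0ℤ < α
  α>0 = ≰⇒> a₀x≰0

  -- The projection along a₀ onto the functionals that vanish at x.
  proj : Vector ℤ _ → Vector ℤ _
  proj b = lin α b (- (b · x)) a₀

  project : Separated (proj ∘ a ∘ suc) (proj c) ⊎ Generated (proj ∘ a ∘ suc) (proj c) →
            Separated a c ⊎ Generated a c
  -- The adjoint of `proj` carries `x′` to `x″`, which lies in the hyperplane `a₀ · x″ = 0`.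
  project (inj₁ (x′ , ax′≤0 , cx′>0)) = inj₁ (x″ ,
    (λ { zero    → ≤-reflexive (trans (·-lin a₀ α x′ (- (a₀ · x′)) x) (cancel α (a₀ · x′)))
       ; (suc i) → subst (_≤ 0ℤ) (sym (adjoint (a (suc i)))) (ax′≤0 i) }) ,
    subst (0ℤ <_) (sym (adjoint c)) cx′>0)
    where
    x″ = lin α x′ (- (a₀ · x′)) x
    cancel : ∀ p q → p * q + (- q) * p ≡ 0ℤ
    cancel = solve-∀
    swap : ∀ p q r s → p * q + (- r) * s ≡ p * q + (- s) * r
    swap = solve-∀
    adjoint : ∀ b → b · x″ ≡ proj b · x′
    adjoint b = trans (·-lin b α x′ (- (a₀ · x′)) x)
      (trans (swap α (b · x′) (a₀ · x′) (b · x)) (sym (lin-· α b (- (b · x)) a₀ x′)))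
  -- Solving for `γ * α * c` collects all multiples of `a₀` in one coefficient `μ`. It is
  -- nonnegative since `c · x > 0` and `a (suc i) · x ≤ 0`.
  project (inj₂ (γ , l , γ>0 , l≥0 , eq)) = inj₂ (γ * α , μ Vector.∷ (λ i → l i * α) ,
    *-pos γ>0 α>0 ,
    (λ { zero    → +-mono-≤ (*-nonNeg (<⇒≤ γ>0) (<⇒≤ cx>0))
                     (∑-nonNeg (λ i → *-nonNeg (l≥0 i) (neg-mono-≤ (ax≤0 i))))
       ; (suc i) → *-nonNeg (l≥0 i) (<⇒≤ α>0) }) ,
    coordinate)
    where
    b = λ i → a (suc i)
    ν = ∑ (λ i → l i * - (b i · x))
    μ = γ * c · x + ν
    expand : ∀ γ α c s a₀ → γ * α * c ≡ γ * (α * c + (- s) * a₀) + a₀ * (γ * s)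
    expand = solve-∀
    term : ∀ l α a s a₀ → l * (α * a + s * a₀) ≡ 1ℤ * (l * α * a) + a₀ * (l * s)
    term = solve-∀
    collect : ∀ s a₀ ν t → 1ℤ * s + a₀ * ν + a₀ * t ≡ (t + ν) * a₀ + s
    collect = solve-∀
    coordinate : ∀ j → γ * α * c j ≡ ∑ (λ i → (μ Vector.∷ (λ i → l i * α)) i * a i j)
    coordinate j = begin
      γ * α * c j
        ≡⟨ expand γ α (c j) (c · x) (a₀ j) ⟩
      γ * proj c j + t
        ≡⟨ cong (λ s → s + t) (eq j) ⟩
      ∑ (λ i → l i * proj (b i) j) + t
        ≡⟨ cong (λ s → s + t) (∑-cong (λ i → term (l i) α (b i j) (- (b i · x)) (a₀ j))) ⟩
      ∑ (λ i → 1ℤ * (l i * α * b i j) + a₀ j * (l i * - (b i · x))) + t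
        ≡⟨ cong (λ s → s + t) (∑-lin 1ℤ (a₀ j) (λ i → l i * α * b i j) (λ i → l i * - (b i · x))) ⟩
      1ℤ * ∑ (λ i → l i * α * b i j) + a₀ j * ν + t
        ≡⟨ collect (∑ (λ i → l i * α * b i j)) (a₀ j) ν (γ * c · x) ⟩
      μ * a₀ j + ∑ (λ i → l i * α * b i j)
        ≡⟨ ∑-suc (λ i → (μ Vector.∷ (λ i → l i * α)) i * a i j) ⟨
      ∑ (λ i → (μ Vector.∷ (λ i → l i * α)) i * a i j) ∎
      where
      open ≡-Reasoning
      t = a₀ j * (γ * c · x)

δ : ∀ {k} → Fin k → Fin k → ℤ
δ zero    zero    = 1ℤ
δ zero    (suc j) = 0ℤ
δ (suc i) zero    = 0ℤ
δ (suc i) (suc j) = δ i j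

δ-sym : ∀ {k} (i j : Fin k) → δ i j ≡ δ j i
δ-sym zero    zero    = refl
δ-sym zero    (suc j) = refl
δ-sym (suc i) zero    = refl
δ-sym (suc i) (suc j) = δ-sym i j

∑-*-zero : ∀ {n} (u : Vector ℤ n) → ∑ (λ i → u i * 0ℤ) ≡ 0ℤ
∑-*-zero u = trans (∑-cong (λ i → *-zeroʳ (u i))) ∑-zero

∑-δ : ∀ {k} (u : Vector ℤ k) j → ∑ (λ i → u i * δ i j) ≡ u j
∑-δ u zero    = trans (∑-suc (λ i → u i * δ i zero))
  (trans (cong₂ _+_ (*-identityʳ (u zero)) (∑-*-zero (u ∘ suc))) (+-identityʳ (u zero)))
∑-δ u (suc j) = trans (∑-suc (λ i → u i * δ i (suc j)))
  (trans (cong₂ _+_ (*-zeroʳ (u zero)) (∑-δ (u ∘ suc) j)) (+-identityˡ (u (suc j))))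

∑-neg-δ : ∀ {k} (u : Vector ℤ k) j → ∑ (λ i → u i * - δ i j) ≡ - u j
∑-neg-δ u j = trans (∑-cong (λ i → shift (u i) (δ i j))) (∑-δ (λ i → - u i) j)
  where
  shift : ∀ a b → a * - b ≡ - a * b
  shift = solve-∀

-- Farkas' lemma with a slack coordinate `s`, whose positivity makes the inequalities strict. A
-- solution yields `l`. In a certificate, the multipliers of the first `n` rows form `c`, and those
-- of the sign rows equal the column sums, which are therefore nonnegative.
ville : ∀ {n k} (v : Vector (Vector ℤ k) n) →
  (∃ λ (c : Vector ℕ n) → 0ℤ < ∑ (λ i → + c i) × (∀ t → 0ℤ ≤ ∑ (λ i → + c i * v i t))) ⊎
  (∃ λ (l : Vector ℕ k) → ∀ i → ∑ (λ t → + l t * v i t) < 0ℤ)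
ville {n} {k} v = solution (farkas a s)
  where
  -- In coordinates (s , l) the system reads  s + v i · l ≤ 0,  - l j ≤ 0,  0 < s.
  belowRow : Vector (Vector ℤ (suc k)) n
  belowRow i = 1ℤ Vector.∷ v i

  signRow : Vector (Vector ℤ (suc k)) k
  signRow j = 0ℤ Vector.∷ (λ t → - δ j t)

  a : Vector (Vector ℤ (suc k)) (n ℕ.+ k)
  a = belowRow Vector.++ signRow

  s : Vector ℤ (suc k)
  s = 1ℤ Vector.∷ (λ _ → 0ℤ)

  split : ∀ (l : Vector ℤ (n ℕ.+ k)) t →
    ∑ (λ i → l i * a i t) ≡ ∑ (λ i → l (i ↑ˡ k) * belowRow i t) + ∑ (λ j → l (n ↑ʳ j) * signRow j t)
  split l t = trans (∑-++ {n} (λ i → l i * a i t)) (cong₂ _+_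
    (∑-cong (λ i → cong (λ b → l (i ↑ˡ k) * b t) (lookup-++ˡ belowRow signRow i)))
    (∑-cong (λ j → cong (λ b → l (n ↑ʳ j) * b t) (lookup-++ʳ belowRow signRow j))))

  solution : Separated a s ⊎ Generated a s → _
  solution (inj₁ (x , ax≤0 , sx>0)) = inj₂ (l , λ i → subst (_< 0ℤ) (reorder i) (below i))
    where
    x≥0 : ∀ j → 0ℤ ≤ x (suc j)
    x≥0 j = neg-cancel-≤ (subst (λ z → z ≤ 0ℤ) eq (ax≤0 (n ↑ʳ j)))
      where
      eq : a (n ↑ʳ j) · x ≡ - x (suc j)
      eq = begin
        a (n ↑ʳ j) · x
          ≡⟨ cong (_· x) (lookup-++ʳ belowRow signRow j) ⟩
        signRow j · x
          ≡⟨ ∑-suc (λ t → signRow j t * x t) ⟩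
        0ℤ * x zero + ∑ (λ t → - δ j t * x (suc t))
          ≡⟨ +-identityˡ (∑ (λ t → - δ j t * x (suc t))) ⟩
        ∑ (λ t → - δ j t * x (suc t))
          ≡⟨ ∑-cong (λ t → trans (*-comm (- δ j t) (x (suc t))) (cong (λ d → x (suc t) * - d) (δ-sym j t))) ⟩
        ∑ (λ t → x (suc t) * - δ t j)
          ≡⟨ ∑-neg-δ (x ∘ suc) j ⟩
        - x (suc j) ∎
        where open ≡-Reasoning

    l : Vector ℕ k
    l t = ∣ x (suc t) ∣

    x₀>0 : 0ℤ < x zero
    x₀>0 = subst (0ℤ <_) (trans (∑-suc (λ t → s t * x t))
      (trans (cong₂ _+_ (*-identityˡ (x zero)) (trans (∑-cong (λ t → *-zeroˡ (x (suc t)))) ∑-zero))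
        (+-identityʳ (x zero)))) sx>0

    below : ∀ i → v i · (x ∘ suc) < 0ℤ
    below i = begin-strict
      v i · (x ∘ suc)                     ≡⟨ +-identityˡ (v i · (x ∘ suc)) ⟨
      0ℤ + v i · (x ∘ suc)                <⟨ +-monoˡ-< (v i · (x ∘ suc)) x₀>0 ⟩
      x zero + v i · (x ∘ suc)            ≡⟨ cong (λ z → z + v i · (x ∘ suc)) (*-identityˡ (x zero)) ⟨
      1ℤ * x zero + v i · (x ∘ suc)       ≡⟨ ∑-suc (λ t → belowRow i t * x t) ⟨
      belowRow i · x                      ≡⟨ cong (_· x) (lookup-++ˡ belowRow signRow i) ⟨
      a (i ↑ˡ k) · x                      ≤⟨ ax≤0 (i ↑ˡ k) ⟩
      0ℤ                                  ∎
      where open ≤-Reasoning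

    reorder : ∀ i → v i · (x ∘ suc) ≡ ∑ (λ t → + l t * v i t)
    reorder i = ∑-cong λ t → trans (*-comm (v i t) (x (suc t)))
      (cong (_* v i t) (sym (0≤i⇒+∣i∣≡i (x≥0 t))))
  solution (inj₂ (γ , l , γ>0 , l≥0 , eq)) = inj₁ (c ,
    subst (0ℤ <_) total γ>0 ,
    λ t → subst (0ℤ ≤_) (column t) (l≥0 (n ↑ʳ t)))
    where
    c : Vector ℕ n
    c i = ∣ l (i ↑ˡ k) ∣

    c≡l : ∀ i → l (i ↑ˡ k) ≡ + c i
    c≡l i = sym (0≤i⇒+∣i∣≡i (l≥0 (i ↑ˡ k)))

    total : γ ≡ ∑ (λ i → + c i)
    total = begin
      γ                                ≡⟨ *-identityʳ γ ⟨
      γ * 1ℤ                           ≡⟨ eq zero ⟩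
      ∑ (λ i → l i * a i zero)         ≡⟨ split l zero ⟩
      ∑ (λ i → l (i ↑ˡ k) * 1ℤ) + ∑ (λ j → l (n ↑ʳ j) * 0ℤ)
        ≡⟨ cong₂ _+_ (∑-cong (λ i → trans (*-identityʳ (l (i ↑ˡ k))) (c≡l i))) (∑-*-zero (λ j → l (n ↑ʳ j))) ⟩
      ∑ (λ i → + c i) + 0ℤ             ≡⟨ +-identityʳ (∑ (λ i → + c i)) ⟩
      ∑ (λ i → + c i)                  ∎
      where open ≡-Reasoning

    column : ∀ t → l (n ↑ʳ t) ≡ ∑ (λ i → + c i * v i t)
    column t = sym (i-j≡0⇒i≡j (∑ (λ i → + c i * v i t)) (l (n ↑ʳ t)) (begin
      ∑ (λ i → + c i * v i t) - l (n ↑ʳ t)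
        ≡⟨ cong₂ _+_ (∑-cong (λ i → cong (_* v i t) (c≡l i))) (∑-neg-δ (λ j → l (n ↑ʳ j)) t) ⟨
      ∑ (λ i → l (i ↑ˡ k) * v i t) + ∑ (λ j → l (n ↑ʳ j) * - δ j t)
        ≡⟨ split l (suc t) ⟨
      ∑ (λ i → l i * a i (suc t))
        ≡⟨ eq (suc t) ⟨
      γ * 0ℤ
        ≡⟨ *-zeroʳ γ ⟩
      0ℤ ∎))
      where open ≡-Reasoning

-- The excess of a family

opaque
  ∑ˢ : ∀ {n} → (Subset n → ℤ) → ℤ
  ∑ˢ {zero}  f = f []
  ∑ˢ {suc n} f = ∑ˢ (λ S → f (outside ∷ S)) + ∑ˢ (λ S → f (inside ∷ S))

  ∑ˢ-[] : (f : Subset 0 → ℤ) → ∑ˢ f ≡ f []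
  ∑ˢ-[] f = refl

  ∑ˢ-∷ : ∀ {n} (f : Subset (suc n) → ℤ) →
    ∑ˢ f ≡ ∑ˢ (λ S → f (outside ∷ S)) + ∑ˢ (λ S → f (inside ∷ S))
  ∑ˢ-∷ f = refl

  ∑ˢ-cong : ∀ {n} {f g : Subset n → ℤ} → (∀ S → f S ≡ g S) → ∑ˢ f ≡ ∑ˢ g
  ∑ˢ-cong {zero}  f≗g = f≗g []
  ∑ˢ-cong {suc n} f≗g = cong₂ _+_ (∑ˢ-cong (λ S → f≗g (outside ∷ S))) (∑ˢ-cong (λ S → f≗g (inside ∷ S)))

  ∑ˢ-zero : ∀ {n} → ∑ˢ {n} (λ _ → 0ℤ) ≡ 0ℤ
  ∑ˢ-zero {zero}  = refl
  ∑ˢ-zero {suc n} = cong₂ _+_ (∑ˢ-zero {n}) (∑ˢ-zero {n})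

  ∑ˢ-lin : ∀ {n} p q (f g : Subset n → ℤ) →
    ∑ˢ (λ S → p * f S + q * g S) ≡ p * ∑ˢ f + q * ∑ˢ g
  ∑ˢ-lin {zero}  p q f g = refl
  ∑ˢ-lin {suc n} p q f g = trans
    (cong₂ _+_ (∑ˢ-lin p q (λ S → f (outside ∷ S)) (λ S → g (outside ∷ S)))
               (∑ˢ-lin p q (λ S → f (inside ∷ S)) (λ S → g (inside ∷ S))))
    (interchange p q (∑ˢ (λ S → f (outside ∷ S))) (∑ˢ (λ S → g (outside ∷ S)))
                     (∑ˢ (λ S → f (inside ∷ S))) (∑ˢ (λ S → g (inside ∷ S))))
    where
    interchange : ∀ p q a b c d → (p * a + q * b) + (p * c + q * d) ≡ p * (a + c) + q * (b + d)
    interchange = solve-∀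

  ∑ˢ-mono : ∀ {n} {f g : Subset n → ℤ} → (∀ S → f S ≤ g S) → ∑ˢ f ≤ ∑ˢ g
  ∑ˢ-mono {zero}  f≤g = f≤g []
  ∑ˢ-mono {suc n} f≤g = +-mono-≤ (∑ˢ-mono (λ S → f≤g (outside ∷ S))) (∑ˢ-mono (λ S → f≤g (inside ∷ S)))

  ∑ˢ-negative : ∀ {n} (f : Subset n → ℤ) → ∑ˢ f < 0ℤ → ∃ λ S → f S < 0ℤ
  ∑ˢ-negative {zero}  f f<0 = [] , f<0
  ∑ˢ-negative {suc n} f f<0 with ∑ˢ (λ S → f (outside ∷ S)) <? 0ℤ
  ... | yes out<0 = let S , fS<0 = ∑ˢ-negative (λ S → f (outside ∷ S)) out<0 in outside ∷ S , fS<0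
  ... | no  out≮0 = let S , fS<0 = ∑ˢ-negative (λ S → f (inside ∷ S)) in<0 in inside ∷ S , fS<0
    where
    in<0 : ∑ˢ (λ S → f (inside ∷ S)) < 0ℤ
    in<0 = ≤-<-trans (≤-trans (≤-reflexive (sym (+-identityˡ (∑ˢ (λ S → f (inside ∷ S))))))
      (+-monoˡ-≤ (∑ˢ (λ S → f (inside ∷ S))) (≮⇒≥ out≮0))) f<0

∑ˢ-+ : ∀ {n} (f g : Subset n → ℤ) → ∑ˢ (λ S → f S + g S) ≡ ∑ˢ f + ∑ˢ g
∑ˢ-+ f g = trans (∑ˢ-cong (λ S → sym (unit (f S) (g S)))) (trans (∑ˢ-lin 1ℤ 1ℤ f g) (unit (∑ˢ f) (∑ˢ g)))
  where
  unit : ∀ a b → 1ℤ * a + 1ℤ * b ≡ a + b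
  unit = solve-∀

∑ˢ-*ˡ : ∀ {n} p (f : Subset n → ℤ) → ∑ˢ (λ S → p * f S) ≡ p * ∑ˢ f
∑ˢ-*ˡ p f = trans (∑ˢ-cong (λ S → sym (pad p (f S)))) (trans (∑ˢ-lin p 0ℤ f f) (pad p (∑ˢ f)))
  where
  pad : ∀ p a → p * a + 0ℤ * a ≡ p * a
  pad = solve-∀

∑ˢ-∑-swap : ∀ {n k} (f : Subset n → Fin k → ℤ) →
  ∑ˢ (λ S → ∑ (f S)) ≡ ∑ (λ i → ∑ˢ (λ S → f S i))
∑ˢ-∑-swap {k = zero}  f = trans (∑ˢ-cong (λ S → ∑-[] (f S)))
  (trans ∑ˢ-zero (sym (∑-[] (λ i → ∑ˢ (λ S → f S i)))))
∑ˢ-∑-swap {k = suc k} f = trans (∑ˢ-cong (λ S → ∑-suc (f S)))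
  (trans (∑ˢ-+ (λ S → f S zero) (λ S → ∑ (λ i → f S (suc i))))
  (trans (cong (λ z → ∑ˢ (λ S → f S zero) + z) (∑ˢ-∑-swap (λ S i → f S (suc i))))
         (sym (∑-suc (λ i → ∑ˢ (λ S → f S i))))))

-- The trace on the last `m` elements is summed outermost, so that the inner sums run over fibres.
∑ˢ-++ : ∀ {n m} (f : Subset (n ℕ.+ m) → ℤ) →
  ∑ˢ f ≡ ∑ˢ (λ (t : Subset m) → ∑ˢ (λ (S : Subset n) → f (S Vec.++ t)))
∑ˢ-++ {zero}  f = ∑ˢ-cong (λ t → sym (∑ˢ-[] (λ S → f (S Vec.++ t))))
∑ˢ-++ {suc n} f = trans (∑ˢ-∷ f) (trans
  (cong₂ _+_ (∑ˢ-++ {n} (λ S → f (outside ∷ S))) (∑ˢ-++ {n} (λ S → f (inside ∷ S))))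
  (trans (sym (∑ˢ-+ (λ t → ∑ˢ (λ (S : Subset n) → f (outside ∷ S Vec.++ t)))
                    (λ t → ∑ˢ (λ (S : Subset n) → f (inside ∷ S Vec.++ t)))))
    (∑ˢ-cong (λ t → sym (∑ˢ-∷ (λ S → f (S Vec.++ t)))))))

sumℤ-++ : ∀ xs ys → sumℤ (xs List.++ ys) ≡ sumℤ xs + sumℤ ys
sumℤ-++ List.[]       ys = sym (+-identityˡ (sumℤ ys))
sumℤ-++ (x List.∷ xs) ys = trans (cong (λ z → x + z) (sumℤ-++ xs ys)) (sym (+-assoc x (sumℤ xs) (sumℤ ys)))

sumℤ-subsets : ∀ {n} (f : Subset n → ℤ) → sumℤ (List.map f (subsets n)) ≡ ∑ˢ f
sumℤ-subsets {zero}  f = trans (+-identityʳ (f [])) (sym (∑ˢ-[] f))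
sumℤ-subsets {suc n} f = begin
  sumℤ (List.map f (outs List.++ ins))
    ≡⟨ cong sumℤ (map-++ f outs ins) ⟩
  sumℤ (List.map f outs List.++ List.map f ins)
    ≡⟨ sumℤ-++ (List.map f outs) (List.map f ins) ⟩
  sumℤ (List.map f outs) + sumℤ (List.map f ins)
    ≡⟨ cong₂ (λ xs ys → sumℤ xs + sumℤ ys) (map-∘ (subsets n)) (map-∘ (subsets n)) ⟨
  sumℤ (List.map (λ S → f (outside ∷ S)) (subsets n)) + sumℤ (List.map (λ S → f (inside ∷ S)) (subsets n))
    ≡⟨ cong₂ _+_ (sumℤ-subsets (λ S → f (outside ∷ S))) (sumℤ-subsets (λ S → f (inside ∷ S))) ⟩
  ∑ˢ (λ S → f (outside ∷ S)) + ∑ˢ (λ S → f (inside ∷ S))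
    ≡⟨ ∑ˢ-∷ f ⟨
  ∑ˢ f ∎
  where
  open ≡-Reasoning
  outs = List.map (outside ∷_) (subsets n)
  ins  = List.map (inside ∷_) (subsets n)

𝟙 : Bool → ℤ
𝟙 b = if b then 1ℤ else 0ℤ

length-filterᵇ : ∀ {A : Set} (p : A → Bool) xs →
  + length (filterᵇ p xs) ≡ sumℤ (List.map (λ x → 𝟙 (p x)) xs)
length-filterᵇ p List.[] = refl
length-filterᵇ p (x List.∷ xs) with p x
... | true  = cong (λ z → 1ℤ + z) (length-filterᵇ p xs)
... | false = trans (length-filterᵇ p xs) (sym (+-identityˡ (sumℤ (List.map (λ x → 𝟙 (p x)) xs))))

∣∣F≡∑ˢ : ∀ {n} (𝓕 : Family n) → + ∣ 𝓕 ∣F ≡ ∑ˢ (incidence 𝓕)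
∣∣F≡∑ˢ {n} 𝓕 = trans (length-filterᵇ 𝓕 (subsets n)) (sumℤ-subsets (incidence 𝓕))

±_ : Bool → ℤ
± b = if b then 1ℤ else -1ℤ

-- The number d(𝓕)ᵢ as a signed count, +1 for a member containing `i` and -1 for any other. In this
-- form it splits over fibres and matches the coefficients of (WV).
excess : ∀ {n} → Family n → Vector ℤ n
excess 𝓕 i = ∑ˢ (λ S → incidence 𝓕 S * ± does (i ∈? S))

excess≡ : ∀ {n} (𝓕 : Family n) i → excess 𝓕 i ≡ + 2 * + ∣ 𝓕 at i ∣F + -1ℤ * + ∣ 𝓕 ∣F
excess≡ 𝓕 i = trans (∑ˢ-cong (λ S → pointwise (𝓕 S) (does (i ∈? S))))
  (trans (∑ˢ-lin (+ 2) -1ℤ (incidence (𝓕 at i)) (incidence 𝓕))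
    (sym (cong₂ (λ a b → + 2 * a + -1ℤ * b) (∣∣F≡∑ˢ (𝓕 at i)) (∣∣F≡∑ˢ 𝓕))))
  where
  pointwise : ∀ a b → 𝟙 a * ± b ≡
    + 2 * 𝟙 (a ∧ b) + -1ℤ * 𝟙 a
  pointwise false b     = refl
  pointwise true  false = refl
  pointwise true  true  = refl

excess-cong : ∀ {n} {𝓕 𝓖 : Family n} → (∀ S → 𝓕 S ≡ 𝓖 S) → ∀ i → excess 𝓕 i ≡ excess 𝓖 i
excess-cong 𝓕≗𝓖 i = ∑ˢ-cong (λ S → cong (λ b → 𝟙 b * ± does (i ∈? S)) (𝓕≗𝓖 S))

∈?-∁ : ∀ {n} i (S : Subset n) → does (i ∈? ∁ S) ≡ not (does (i ∈? S))
∈?-∁ zero    (inside  ∷ S) = refl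
∈?-∁ zero    (outside ∷ S) = refl
∈?-∁ (suc i) (s ∷ S)       = ∈?-∁ i S

∈?-++ : ∀ {n m} i (S : Subset n) (t : Subset m) → does (i ↑ˡ m ∈? (S Vec.++ t)) ≡ does (i ∈? S)
∈?-++ zero    (inside  ∷ S) t = refl
∈?-++ zero    (outside ∷ S) t = refl
∈?-++ (suc i) (s ∷ S)       t = ∈?-++ i S t

fibre : ∀ {n m} → Family (n ℕ.+ m) → Subset m → Family n
fibre 𝓕 t S = 𝓕 (S Vec.++ t)

excess-fibre : ∀ {n m} (𝓕 : Family (n ℕ.+ m)) i →
  excess 𝓕 (i ↑ˡ m) ≡ ∑ˢ (λ t → excess (fibre 𝓕 t) i)
excess-fibre {n} 𝓕 i = trans (∑ˢ-++ {n} (λ S → incidence 𝓕 S * ± does ((i ↑ˡ _) ∈? S)))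
  (∑ˢ-cong (λ t → ∑ˢ-cong (λ S → cong (λ b → incidence 𝓕 (S Vec.++ t) * ± b) (∈?-++ i S t))))

weight-difference : ∀ {n} (c : Vector ℕ n) S →
  + weight c S - + weight c (∁ S) ≡ ∑ (λ i → + c i * ± does (i ∈? S))
weight-difference c S = trans
  (cong (λ w → + weight c S - + w) (ℕ-sum.sum-cong-≗ (λ i → cong (λ b → if b then c i else 0) (∈?-∁ i S))))
  (difference c (λ i → does (i ∈? S)))
  where
  difference : ∀ {n} (c : Vector ℕ n) (b : Fin n → Bool) →
    + ℕ-sum.sum (λ i → if b i then c i else 0) - + ℕ-sum.sum (λ i → if not (b i) then c i else 0) ≡
    ∑ (λ i → + c i * ± b i)
  difference {zero}  c b = sym (∑-[] (λ i → + c i * ± b i))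
  difference {suc n} c b = begin
    + (x ℕ.+ u) - + (y ℕ.+ v)             ≡⟨ cong₂ _-_ (pos-+ x u) (pos-+ y v) ⟩
    (+ x + + u) - (+ y + + v)             ≡⟨ interchange (+ x) (+ u) (+ y) (+ v) ⟩
    (+ x - + y) + (+ u - + v)             ≡⟨ cong₂ _+_ (head (c zero) (b zero)) (difference (c ∘ suc) (b ∘ suc)) ⟩
    + c zero * ± b zero + ∑ (λ i → + c (suc i) * ± b (suc i)) ≡⟨ ∑-suc (λ i → + c i * ± b i) ⟨
    ∑ (λ i → + c i * ± b i) ∎
    where
    open ≡-Reasoning
    x = if b zero then c zero else 0
    y = if not (b zero) then c zero else 0
    u = ℕ-sum.sum (λ i → if b (suc i) then c (suc i) else 0)
    v = ℕ-sum.sum (λ i → if not (b (suc i)) then c (suc i) else 0)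
    interchange : ∀ x u y v → (x + u) - (y + v) ≡ (x - y) + (u - v)
    interchange = solve-∀
    plus : ∀ i → i - 0ℤ ≡ i * 1ℤ
    plus = solve-∀
    minus : ∀ i → 0ℤ - i ≡ i * -1ℤ
    minus = solve-∀
    head : ∀ a b → + (if b then a else 0) - + (if not b then a else 0) ≡ + a * ± b
    head a true  = plus (+ a)
    head a false = minus (+ a)

infix 8 _∙_
_∙_ : ∀ {n} → Vector ℕ n → Vector ℤ n → ℤ
c ∙ v = ∑ (λ i → + c i * v i)

-- Exchanging the sums over `S` and over `i` turns the left side of (WV), without its `+ 1`, into a
-- linear functional of the excess.
WV-sum : ∀ {n} (c : Vector ℕ n) (𝓑 : Family n) →
  sumℤ (List.map (λ S → (+ weight c S - + weight c (∁ S)) * incidence 𝓑 S) (subsets n)) ≡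
  c ∙ excess 𝓑
WV-sum {n} c 𝓑 = begin
  sumℤ (List.map (λ S → (+ weight c S - + weight c (∁ S)) * incidence 𝓑 S) (subsets n))
    ≡⟨ sumℤ-subsets (λ S → (+ weight c S - + weight c (∁ S)) * incidence 𝓑 S) ⟩
  ∑ˢ (λ S → (+ weight c S - + weight c (∁ S)) * incidence 𝓑 S)
    ≡⟨ ∑ˢ-cong term ⟩
  ∑ˢ (λ S → ∑ (λ i → + c i * (incidence 𝓑 S * ± does (i ∈? S))))
    ≡⟨ ∑ˢ-∑-swap (λ S i → + c i * (incidence 𝓑 S * ± does (i ∈? S))) ⟩
  ∑ (λ i → ∑ˢ (λ S → + c i * (incidence 𝓑 S * ± does (i ∈? S))))
    ≡⟨ ∑-cong (λ i → ∑ˢ-*ˡ (+ c i) (λ S → incidence 𝓑 S * ± does (i ∈? S))) ⟩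
  c ∙ excess 𝓑 ∎
  where
  open ≡-Reasoning
  rearrange : ∀ x c s → x * (c * s) ≡ c * (x * s)
  rearrange = solve-∀
  term : ∀ S → (+ weight c S - + weight c (∁ S)) * incidence 𝓑 S ≡
    ∑ (λ i → + c i * (incidence 𝓑 S * ± does (i ∈? S)))
  term S = trans (cong (_* incidence 𝓑 S) (weight-difference c S))
    (trans (*-comm (∑ (λ i → + c i * ± does (i ∈? S))) (incidence 𝓑 S))
    (trans (∑-*ˡ (incidence 𝓑 S) (λ i → + c i * ± does (i ∈? S)))
      (∑-cong (λ i → rearrange (incidence 𝓑 S) (+ c i) (± does (i ∈? S))))))

-- Rational points and their integer multiples

-- c = g y, cleared of denominators.
Scales : ∀ {n} → ℕ → Vector ℚᵘ n → Vector ℤ n → Set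
Scales g y e = ∀ i → ↥ (y i) * + g ≡ e i * ↧ (y i)

-- Cross-multiplication is additive here because unnormalised addition takes the product of the
-- denominators.
sumℚ-scales : ∀ {n} g (y : Vector ℚᵘ n) e → Scales g y e →
  ↥ (sumℚ y) * + g ≡ ∑ e * ↧ (sumℚ y)
sumℚ-scales {zero}  g y e eq = sym (trans (*-identityʳ (∑ e)) (∑-[] e))
sumℚ-scales {suc n} g y e eq = trans
  (addition (y zero) (sumℚ (y ∘ suc)) (e zero) (∑ (e ∘ suc)) (eq zero) (sumℚ-scales g (y ∘ suc) (e ∘ suc) (eq ∘ suc)))
  (cong (_* ↧ (sumℚ y)) (sym (∑-suc e)))
  where
  expand : ∀ a b c d g → (a * d + c * b) * g ≡ a * g * d + c * g * b
  expand = solve-∀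
  collect : ∀ x z b d → x * b * d + z * d * b ≡ (x + z) * (b * d)
  collect = solve-∀
  addition : ∀ p q x z → ↥ p * + g ≡ x * ↧ p → ↥ q * + g ≡ z * ↧ q →
    ↥ (p ℚ.+ q) * + g ≡ (x + z) * ↧ (p ℚ.+ q)
  addition p@(mkℚᵘ a b) q@(mkℚᵘ c d) x z eq₁ eq₂ = begin
    (a * ↧ q + c * ↧ p) * + g          ≡⟨ expand a (↧ p) c (↧ q) (+ g) ⟩
    a * + g * ↧ q + c * + g * ↧ p      ≡⟨ cong₂ (λ u v → u * ↧ q + v * ↧ p) eq₁ eq₂ ⟩
    x * ↧ p * ↧ q + z * ↧ q * ↧ p      ≡⟨ collect x z (↧ p) (↧ q) ⟩
    (x + z) * (↧ p * ↧ q)              ∎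
    where open ≡-Reasoning

module _ {n} (g : ℕ) .{{_ : ℕ.NonZero g}} (y : Vector ℚᵘ n) (c : Vector ℕ n)
         (scales : Scales g y (+_ ∘ c)) where

  private
    ↧≢0 : ∀ p → NonZero (↧ p)
    ↧≢0 (mkℚᵘ a b) = _

    +g≢0 : NonZero (+ g)
    +g≢0 = ≢-nonZero (λ eq → ℕ.≢-nonZero⁻¹ g (+-injective eq))

  total-scaled : sumℚ y ℚ.≃ ℚ.1ℚᵘ → ∑ (+_ ∘ c) ≡ + g
  total-scaled (*≡* eq) = *-cancelʳ-≡ (∑ (+_ ∘ c)) (+ g) (↧ s) {{↧≢0 s}} (begin
    ∑ (+_ ∘ c) * ↧ s     ≡⟨ sumℚ-scales g y (+_ ∘ c) scales ⟨
    ↥ s * + g            ≡⟨ cong (_* + g) (trans (sym (*-identityʳ (↥ s))) (trans eq (*-identityˡ (↧ s)))) ⟩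
    ↧ s * + g            ≡⟨ *-comm (↧ s) (+ g) ⟩
    + g * ↧ s            ∎)
    where
    open ≡-Reasoning
    s = sumℚ y

  total-unscaled : ∑ (+_ ∘ c) ≡ + g → sumℚ y ℚ.≃ ℚ.1ℚᵘ
  total-unscaled eq = *≡* (*-cancelʳ-≡ (↥ s * 1ℤ) (1ℤ * ↧ s) (+ g) {{+g≢0}} (begin
    ↥ s * 1ℤ * + g       ≡⟨ cong (_* + g) (*-identityʳ (↥ s)) ⟩
    ↥ s * + g            ≡⟨ sumℚ-scales g y (+_ ∘ c) scales ⟩
    ∑ (+_ ∘ c) * ↧ s     ≡⟨ cong (_* ↧ s) eq ⟩
    + g * ↧ s            ≡⟨ swap (+ g) (↧ s) ⟩
    1ℤ * ↧ s * + g       ∎))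
    where
    open ≡-Reasoning
    s = sumℚ y
    swap : ∀ a b → a * b ≡ 1ℤ * b * a
    swap = solve-∀

  module _ (total : ∑ (+_ ∘ c) ≡ + g) (𝓑 : Family n) where

    private
      b : Vector ℤ n
      b i = + ∣ 𝓑 at i ∣F
      w : Vector ℚᵘ n
      w i = y i ℚ.* (b i ℚ./ 1)
      s = sumℚ w
      N = + ∣ 𝓑 ∣F
      t = c ∙ b

      w-scales : Scales g w (λ i → + c i * b i)
      w-scales i = term (y i) (b i) (+ c i) (scales i)
        where
        swap : ∀ a b c → a * b * c ≡ a * c * b
        swap = solve-∀
        term : ∀ p b x → ↥ p * + g ≡ x * ↧ p → ↥ (p ℚ.* (b ℚ./ 1)) * + g ≡ x * b * ↧ (p ℚ.* (b ℚ./ 1))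
        term p@(mkℚᵘ a d) b x eq = begin
          a * b * + g           ≡⟨ swap a b (+ g) ⟩
          a * + g * b           ≡⟨ cong (_* b) eq ⟩
          x * ↧ p * b           ≡⟨ swap x (↧ p) b ⟩
          x * b * ↧ p           ≡⟨ cong (λ z → x * b * z) (*-identityʳ (↧ p)) ⟨
          x * b * (↧ p * 1ℤ)    ∎
          where open ≡-Reasoning

      -- The right side is `2 * g` times the slack of the halfspace inequality at `y`, so the cut of
      -- `𝓑` becomes a sign condition on `c ∙ excess 𝓑`.
      excess-total : c ∙ excess 𝓑 ≡ + 2 * t - N * + g
      excess-total = begin
        c ∙ excess 𝓑
          ≡⟨ ∑-cong (λ i → trans (cong (+ c i *_) (excess≡ 𝓑 i)) (distrib (+ c i) (b i) N)) ⟩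
        ∑ (λ i → + 2 * (+ c i * b i) + - N * + c i)
          ≡⟨ ∑-lin (+ 2) (- N) (λ i → + c i * b i) (+_ ∘ c) ⟩
        + 2 * t + - N * ∑ (+_ ∘ c)
          ≡⟨ cong (λ z → + 2 * t + - N * z) total ⟩
        + 2 * t + - N * + g
          ≡⟨ cong (λ z → + 2 * t + z) (neg-distribˡ-* N (+ g)) ⟨
        + 2 * t - N * + g ∎
        where
        open ≡-Reasoning
        distrib : ∀ c b n → c * (+ 2 * b + -1ℤ * n) ≡ + 2 * (c * b) + - n * c
        distrib = solve-∀

      -- The cross-multiplied sides of the halfspace inequality, times `g`. Both turn into integers
      -- times `↧ s`, which can then be cancelled.
      left right : ℤ
      left  = N * ↧ s * + g
      right = ↥ s * + 2 * + g

      left≡ : left ≡ N * + g * ↧ s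
      left≡ = swap N (↧ s) (+ g)
        where
        swap : ∀ a b c → a * b * c ≡ a * c * b
        swap = solve-∀

      right≡ : right ≡ + 2 * t * ↧ s
      right≡ = trans (swap (↥ s) (+ 2) (+ g)) (trans (cong (+ 2 *_) (sumℚ-scales g w (λ i → + c i * b i) w-scales))
        (sym (*-assoc (+ 2) t (↧ s))))
        where
        swap : ∀ a b c → a * b * c ≡ b * (a * c)
        swap = solve-∀

      ↧-positive : ∀ p → Positive (↧ p)
      ↧-positive (mkℚᵘ a d) = _

      +g-positive : Positive (+ g)
      +g-positive = positive (+<+ (ℕ.>-nonZero⁻¹ g))

    excess-of-halfspace : halfspace 𝓑 y → 0ℤ ≤ c ∙ excess 𝓑
    excess-of-halfspace (*≤* le) = subst (0ℤ ≤_) (sym excess-total) (i≤j⇒0≤j-i {N * + g} {+ 2 * t}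
      (*-cancelʳ-≤-pos (N * + g) (+ 2 * t) (↧ s) {{↧-positive s}}
        (subst₂ _≤_ left≡ right≡ (*-monoʳ-≤-nonNeg (+ g) {N * ↧ s} {↥ s * + 2} le))))

    halfspace-of-excess : 0ℤ ≤ c ∙ excess 𝓑 → halfspace 𝓑 y
    halfspace-of-excess 0≤ = *≤* (*-cancelʳ-≤-pos (N * ↧ s) (↥ s * + 2) (+ g) {{+g-positive}}
      (subst₂ _≤_ (sym left≡) (sym right≡)
        (*-monoʳ-≤-nonNeg (↧ s) {{_}} {N * + g} {+ 2 * t}
          (0≤i-j⇒j≤i {+ 2 * t} {N * + g} (subst (0ℤ ≤_) excess-total 0≤)))))

lcm-nonZero : ∀ m n → .{{ℕ.NonZero m}} → .{{ℕ.NonZero n}} → ℕ.NonZero (lcm m n)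
lcm-nonZero m n = ℕ.≢-nonZero λ lcm≡0 → ℕ.≢-nonZero⁻¹ (m ℕ.* n) {{ℕ.m*n≢0 m n}}
  (trans (sym (gcd*lcm m n)) (trans (cong (gcd m n ℕ.*_) lcm≡0) (ℕ.*-zeroʳ (gcd m n))))

commonDenominator-nonZero : ∀ {n} (y : Vector ℚᵘ n) → ℕ.NonZero (commonDenominator y)
commonDenominator-nonZero {zero}  y = _
commonDenominator-nonZero {suc n} y = lcm-nonZero (↧ₙ (y zero)) (commonDenominator (y ∘ suc))
  {{_}} {{commonDenominator-nonZero (y ∘ suc)}}

↧∣commonDenominator : ∀ {n} (y : Vector ℚᵘ n) i → ↧ₙ (y i) ∣ commonDenominator y
↧∣commonDenominator y zero    = m∣lcm[m,n] (↧ₙ (y zero)) (commonDenominator (y ∘ suc))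
↧∣commonDenominator y (suc i) = ∣-trans (↧∣commonDenominator (y ∘ suc) i)
  (n∣lcm[m,n] (↧ₙ (y zero)) (commonDenominator (y ∘ suc)))

-- Nonnegativity makes `∣ ↥ (y i) ∣` the numerator itself, and `↧ₙ (y i)` divides the common
-- denominator, so the division in `scaled` is exact.
scaled-scales : ∀ {n} (y : Vector ℚᵘ n) → (∀ i → 0ℚᵘ ℚ.≤ y i) →
  Scales (commonDenominator y) y (+_ ∘ scaled y)
scaled-scales y y≥0 i = begin
  ↥ (y i) * + g                            ≡⟨ cong (_* + g) (numerator (y≥0 i)) ⟨
  + a * + g                                ≡⟨ pos-* a g ⟨
  + (a ℕ.* g)                              ≡⟨ cong (λ m → + (a ℕ.* m)) (m/n*n≡m (↧∣commonDenominator y i)) ⟨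
  + (a ℕ.* (g ℕ./ d ℕ.* d))                ≡⟨ cong +_ (ℕ.*-assoc a (g ℕ./ d) d) ⟨
  + (scaled y i ℕ.* d)                     ≡⟨ pos-* (scaled y i) d ⟩
  + scaled y i * ↧ (y i)                   ∎
  where
  open ≡-Reasoning
  g = commonDenominator y
  a = ∣ ↥ (y i) ∣
  d = ↧ₙ (y i)
  numerator : ∀ {p} → 0ℚᵘ ℚ.≤ p → + ∣ ↥ p ∣ ≡ ↥ p
  numerator {p} (*≤* le) = 0≤i⇒+∣i∣≡i (subst₂ _≤_ (*-zeroˡ (↧ p)) (*-identityʳ (↥ p)) le)

-- Enumeration of families, and membership in X(𝓐,c)

-- This is 2^(2^n): a family on n + 1 elements is a pair of families on n elements, the members
-- without and with the first element.
familyCount : ℕ → ℕ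
familyCount zero    = 2
familyCount (suc n) = familyCount n ℕ.* familyCount n

-- Codes give families a finite index set, for exhaustive search and for counting the cuts.
encode : ∀ {n} → Family n → Fin (familyCount n)
encode {zero}  𝓑 = if 𝓑 [] then suc zero else zero
encode {suc n} 𝓑 = combine (encode (𝓑 ∘ (outside ∷_))) (encode (𝓑 ∘ (inside ∷_)))

decode : ∀ {n} → Fin (familyCount n) → Family n
decode {zero}  zero       []            = false
decode {zero}  (suc zero) []            = true
decode {suc n} k          (outside ∷ S) = decode (proj₁ (remQuot {familyCount n} (familyCount n) k)) S
decode {suc n} k          (inside  ∷ S) = decode (proj₂ (remQuot {familyCount n} (familyCount n) k)) S

decode-encode : ∀ {n} (𝓑 : Family n) S → decode (encode 𝓑) S ≡ 𝓑 S
decode-encode {zero} 𝓑 [] with 𝓑 []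
... | false = refl
... | true  = refl
decode-encode {suc n} 𝓑 (outside ∷ S) = trans
  (cong (λ k → decode (proj₁ k) S) (remQuot-combine (encode (𝓑 ∘ (outside ∷_))) (encode (𝓑 ∘ (inside ∷_)))))
  (decode-encode (𝓑 ∘ (outside ∷_)) S)
decode-encode {suc n} 𝓑 (inside ∷ S) = trans
  (cong (λ k → decode (proj₂ k) S) (remQuot-combine (encode (𝓑 ∘ (outside ∷_))) (encode (𝓑 ∘ (inside ∷_)))))
  (decode-encode (𝓑 ∘ (inside ∷_)) S)

encode-injective : ∀ {n} {𝓑 𝓒 : Family n} → encode 𝓑 ≡ encode 𝓒 → ∀ S → 𝓑 S ≡ 𝓒 S
encode-injective {𝓑 = 𝓑} {𝓒} eq S =
  trans (sym (decode-encode 𝓑 S)) (trans (cong (λ k → decode k S) eq) (decode-encode 𝓒 S))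

-- Searching the codes suffices once `P` respects pointwise equality, in which sense
-- `decode (encode 𝓑)` agrees with `𝓑`.
anyFamily? : ∀ {n} {P : Family n → Set} →
  (∀ {𝓑 𝓒} → (∀ S → 𝓑 S ≡ 𝓒 S) → P 𝓑 → P 𝓒) → Decidable P → Dec (∃ P)
anyFamily? resp P? = map′ (λ (k , p) → decode k , p)
  (λ (𝓑 , p) → encode 𝓑 , resp (λ S → sym (decode-encode 𝓑 S)) p) (any? (P? ∘ decode))

allSubsets? : ∀ {n} {P : Subset n → Set} → Decidable P → Dec (∀ S → P S)
allSubsets? P? = map′ (λ ¬∃ S → decidable-stable (P? S) (λ ¬p → ¬∃ (S , ¬p)))
  (λ ∀p (S , ¬p) → ¬p (∀p S)) (¬? (anySubset? (¬? ∘ P?)))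

Closed : ∀ {n} → Family n → Set
Closed 𝓑 = ∀ S S′ → S ∈F 𝓑 → S′ ∈F 𝓑 → (S ∪ S′) ∈F 𝓑

Absorbs : ∀ {n} → Family n → Family n → Set
Absorbs 𝓐 𝓑 = ∀ S A → A ∈F 𝓐 → S ∈F 𝓑 → (A ∪ S) ∈F 𝓑

-- (UC), (FS) and (WV) for an incidence vector, read as conditions on the family. Over the integers,
-- the `+ 1` in (WV) expresses strictness.
Admissible : ∀ {n} → Family n → Vector ℕ n → Family n → Set
Admissible 𝓐 c 𝓑 = Closed 𝓑 × Absorbs 𝓐 𝓑 × c ∙ excess 𝓑 < 0ℤ

admissible-resp : ∀ {n} {𝓐 : Family n} {c 𝓑 𝓒} → (∀ S → 𝓑 S ≡ 𝓒 S) →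
  Admissible 𝓐 c 𝓑 → Admissible 𝓐 c 𝓒
admissible-resp {c = c} {𝓑} {𝓒} 𝓑≗𝓒 (closed , absorbs , neg) =
  (λ S S′ p q → to (S ∪ S′) (closed S S′ (from S p) (from S′ q))) ,
  (λ S A a p → to (A ∪ S) (absorbs S A a (from S p))) ,
  subst (_< 0ℤ) (∑-cong (λ i → cong (+ c i *_) (excess-cong 𝓑≗𝓒 i))) neg
  where
  to : ∀ S → S ∈F 𝓑 → S ∈F 𝓒
  to S = subst T (𝓑≗𝓒 S)
  from : ∀ S → S ∈F 𝓒 → S ∈F 𝓑
  from S = subst T (sym (𝓑≗𝓒 S))

admissible? : ∀ {n} (𝓐 : Family n) c → Decidable (Admissible 𝓐 c)
admissible? 𝓐 c 𝓑 =
  allSubsets? (λ S → allSubsets? (λ S′ → T? (𝓑 S) →-dec T? (𝓑 S′) →-dec T? (𝓑 (S ∪ S′)))) ×-dec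
  allSubsets? (λ S → allSubsets? (λ A → T? (𝓐 A) →-dec T? (𝓑 S) →-dec T? (𝓑 (A ∪ S)))) ×-dec
  (c ∙ excess 𝓑 <? 0ℤ)

private
  𝟙-union⁻ : ∀ a b c → 𝟙 a + 𝟙 b ≤ 1ℤ + 𝟙 c → T a → T b → T c
  𝟙-union⁻ true true true  _               _ _ = _
  𝟙-union⁻ true true false (+≤+ (ℕ.s≤s ())) _ _

  𝟙-union⁺ : ∀ a b c → (T a → T b → T c) → 𝟙 a + 𝟙 b ≤ 1ℤ + 𝟙 c
  𝟙-union⁺ false false false h = +≤+ ℕ.z≤n
  𝟙-union⁺ false false true  h = +≤+ ℕ.z≤n
  𝟙-union⁺ false true  false h = ≤-refl
  𝟙-union⁺ false true  true  h = +≤+ (ℕ.s≤s ℕ.z≤n)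
  𝟙-union⁺ true  false false h = ≤-refl
  𝟙-union⁺ true  false true  h = +≤+ (ℕ.s≤s ℕ.z≤n)
  𝟙-union⁺ true  true  true  h = ≤-refl
  𝟙-union⁺ true  true  false h = contradiction _ (h _)

  𝟙-mono⁻ : ∀ a b → 𝟙 a ≤ 𝟙 b → T a → T b
  𝟙-mono⁻ true true  _        _ = _
  𝟙-mono⁻ true false (+≤+ ()) _

  𝟙-mono⁺ : ∀ a b → (T a → T b) → 𝟙 a ≤ 𝟙 b
  𝟙-mono⁺ false false h = ≤-refl
  𝟙-mono⁺ false true  h = +≤+ ℕ.z≤n
  𝟙-mono⁺ true  true  h = ≤-refl
  𝟙-mono⁺ true  false h = contradiction _ h

  0≤𝟙 : ∀ a → 0ℤ ≤ 𝟙 a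
  0≤𝟙 false = ≤-refl
  0≤𝟙 true  = +≤+ ℕ.z≤n

  𝟙≤1 : ∀ a → 𝟙 a ≤ 1ℤ
  𝟙≤1 false = +≤+ ℕ.z≤n
  𝟙≤1 true  = ≤-refl

module _ {n} {𝓐 : Family n} {c : Vector ℕ n} where

  X⇒admissible : ∀ {x} 𝓑 → (∀ S → x S ≡ incidence 𝓑 S) → X 𝓐 c x → Admissible 𝓐 c 𝓑
  X⇒admissible {x} 𝓑 x≗𝓑 X-x =
    (λ S S′ → 𝟙-union⁻ (𝓑 S) (𝓑 S′) (𝓑 (S ∪ S′))
      (subst₂ _≤_ (cong₂ _+_ (x≗𝓑 S) (x≗𝓑 S′)) (cong (λ z → 1ℤ + z) (x≗𝓑 (S ∪ S′))) (X.UC X-x S S′))) ,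
    (λ S A a → 𝟙-mono⁻ (𝓑 S) (𝓑 (A ∪ S))
      (subst₂ _≤_ (x≗𝓑 S) (x≗𝓑 (A ∪ S)) (X.FS X-x S A a))) ,
    suc[i]≤j⇒i<j (subst (_≤ 0ℤ) (trans (cong (_+ 1ℤ) (trans
      (cong sumℤ (map-cong (λ S → cong ((+ weight c S - + weight c (∁ S)) *_) (x≗𝓑 S)) (subsets n)))
      (WV-sum c 𝓑))) (+-comm (c ∙ excess 𝓑) 1ℤ)) (X.WV X-x))

  admissible⇒X : ∀ 𝓑 → Admissible 𝓐 c 𝓑 → X 𝓐 c (incidence 𝓑)
  admissible⇒X 𝓑 (closed , absorbs , neg) = record
    { UC    = λ S S′ → 𝟙-union⁺ (𝓑 S) (𝓑 S′) (𝓑 (S ∪ S′)) (closed S S′)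
    ; WV    = subst (_≤ 0ℤ) (trans (+-comm 1ℤ (c ∙ excess 𝓑)) (cong (_+ 1ℤ) (sym (WV-sum c 𝓑))))
                (i<j⇒suc[i]≤j neg)
    ; FS    = λ S A a → 𝟙-mono⁺ (𝓑 S) (𝓑 (A ∪ S)) (absorbs S A a)
    ; lower = λ S → 0≤𝟙 (𝓑 S)
    ; upper = λ S → 𝟙≤1 (𝓑 S)
    }

support : ∀ {n} → (Subset n → ℤ) → Family n
support x S = does (x S ℤ.≟ 1ℤ)

-- The bounds leave only the values 0 and 1 to an integer entry.
support-incidence : ∀ {n} {𝓐 : Family n} {c x} → X 𝓐 c x → ∀ S → x S ≡ incidence (support x) S
support-incidence {x = x} X-x S = binary (x S) (X.lower X-x S) (X.upper X-x S)
  where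
  binary : ∀ k → 0ℤ ≤ k → k ≤ 1ℤ → k ≡ 𝟙 (does (k ℤ.≟ 1ℤ))
  binary (+ 0) _ _ = refl
  binary (+ 1) _ _ = refl
  binary (+ suc (suc k)) _ (+≤+ (ℕ.s≤s ()))

-- Non-FC-families from combinations of cuts

-- Bounds what the copy of `𝓐` at the bottom of the tower contributes.
excess≤∣∣F : ∀ {n} (𝓕 : Family n) i → excess 𝓕 i ≤ + ∣ 𝓕 ∣F
excess≤∣∣F 𝓕 i = subst (excess 𝓕 i ≤_) (sym (∣∣F≡∑ˢ 𝓕))
  (∑ˢ-mono (λ S → pointwise (𝓕 S) (does (i ∈? S))))
  where
  pointwise : ∀ a b → 𝟙 a * ± b ≤ 𝟙 a
  pointwise false b     = ≤-refl
  pointwise true  false = -≤+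
  pointwise true  true  = ≤-refl

excess≡- : ∀ {n} (𝓕 : Family n) i → excess 𝓕 i ≡ + (2 ℕ.* ∣ 𝓕 at i ∣F) - + ∣ 𝓕 ∣F
excess≡- 𝓕 i = trans (excess≡ 𝓕 i) (cong₂ _+_ (sym (pos-* 2 ∣ 𝓕 at i ∣F)) (-1*i≡-i (+ ∣ 𝓕 ∣F)))

rare⇒excess<0 : ∀ {n} (𝓕 : Family n) i → 2 ℕ.* ∣ 𝓕 at i ∣F ℕ.< ∣ 𝓕 ∣F → excess 𝓕 i < 0ℤ
rare⇒excess<0 𝓕 i lt = subst₂ _<_ (sym (excess≡- 𝓕 i)) (+-inverseʳ (+ ∣ 𝓕 ∣F))
  (+-monoˡ-< (- (+ ∣ 𝓕 ∣F)) (+<+ lt))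

excess<0⇒rare : ∀ {n} (𝓕 : Family n) i → excess 𝓕 i < 0ℤ → 2 ℕ.* ∣ 𝓕 at i ∣F ℕ.< ∣ 𝓕 ∣F
excess<0⇒rare 𝓕 i neg = drop‿+<+ (subst₂ _<_ (cancel (+ (2 ℕ.* ∣ 𝓕 at i ∣F)) (+ ∣ 𝓕 ∣F)) (+-identityˡ (+ ∣ 𝓕 ∣F))
  (+-monoˡ-< (+ ∣ 𝓕 ∣F) (subst (_< 0ℤ) (excess≡- 𝓕 i) neg)))
  where
  cancel : ∀ x y → x - y + y ≡ x
  cancel = solve-∀

-- Inverse to taking fibres: the fibre over `t` is `𝓖 t`.
glue : ∀ n {m} → (Subset m → Family n) → Family (n ℕ.+ m)
glue zero    𝓖 t       = 𝓖 t []
glue (suc n) 𝓖 (s ∷ v) = glue n (λ t S → 𝓖 t (s ∷ S)) v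

glue-++ : ∀ {n m} (𝓖 : Subset m → Family n) S t → glue n 𝓖 (S Vec.++ t) ≡ 𝓖 t S
glue-++ 𝓖 []      t = refl
glue-++ 𝓖 (s ∷ S) t = glue-++ (λ t S → 𝓖 t (s ∷ S)) S t

glue-closed : ∀ {n m} (𝓖 : Subset m → Family n) →
  (∀ t t′ S S′ → S ∈F 𝓖 t → S′ ∈F 𝓖 t′ → (S ∪ S′) ∈F 𝓖 (t ∪ t′)) → Closed (glue n 𝓖)
glue-closed {n} 𝓖 closed v v′ p p′ with Vec.splitAt n v | Vec.splitAt n v′
... | S , t , refl | S′ , t′ , refl = subst T
  (trans (sym (glue-++ 𝓖 (S ∪ S′) (t ∪ t′))) (cong (glue n 𝓖) (sym (zipWith-++ _ S t S′ t′))))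
  (closed t t′ S S′ (subst T (glue-++ 𝓖 S t) p) (subst T (glue-++ 𝓖 S′ t′) p′))

T-∧⁻ : ∀ {a b} → T (a ∧ b) → T a × T b
T-∧⁻ = Equivalence.to T-∧

T-∧⁺ : ∀ {a b} → T a → T b → T (a ∧ b)
T-∧⁺ p q = Equivalence.from T-∧ (p , q)

isFull isEmpty : ∀ {m} → Subset m → Bool
isFull []            = true
isFull (inside  ∷ t) = isFull t
isFull (outside ∷ t) = false
isEmpty []            = true
isEmpty (inside  ∷ t) = false
isEmpty (outside ∷ t) = isEmpty t

isFull-∪ˡ : ∀ {m} (t t′ : Subset m) → T (isFull t) → T (isFull (t ∪ t′))
isFull-∪ˡ []           []        p = _
isFull-∪ˡ (inside ∷ t) (s′ ∷ t′) p = isFull-∪ˡ t t′ p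

isEmpty⇒≡⊥ : ∀ {m} (t : Subset m) → T (isEmpty t) → t ≡ ⊥
isEmpty⇒≡⊥ []            p = refl
isEmpty⇒≡⊥ (outside ∷ t) p = cong (outside ∷_) (isEmpty⇒≡⊥ t p)

isEmpty-⊥ : ∀ m → T (isEmpty (⊥ {m}))
isEmpty-⊥ zero    = _
isEmpty-⊥ (suc m) = isEmpty-⊥ m

-- Exactly one subset is full, so only its term survives.
∑ˢ-isFull : ∀ {m} (f : Bool → ℤ) → f false ≡ 0ℤ → ∑ˢ {m} (λ t → f (isFull t)) ≡ f true
∑ˢ-isFull {zero}  f f0 = ∑ˢ-[] (λ t → f (isFull t))
∑ˢ-isFull {suc m} f f0 = trans (∑ˢ-∷ (λ t → f (isFull t))) (trans
  (cong₂ _+_ (trans (∑ˢ-cong {m} (λ _ → f0)) ∑ˢ-zero) (∑ˢ-isFull {m} f f0)) (+-identityˡ (f true)))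

∑ˢ-isEmpty : ∀ {m} (f : Bool → ℤ) → f false ≡ 0ℤ → ∑ˢ {m} (λ t → f (isEmpty t)) ≡ f true
∑ˢ-isEmpty {zero}  f f0 = ∑ˢ-[] (λ t → f (isEmpty t))
∑ˢ-isEmpty {suc m} f f0 = trans (∑ˢ-∷ (λ t → f (isEmpty t))) (trans
  (cong₂ _+_ (∑ˢ-isEmpty {m} f f0) (trans (∑ˢ-cong {m} (λ _ → f0)) ∑ˢ-zero)) (+-identityʳ (f true)))

excess-∅ : ∀ {n} (i : Fin n) → excess (λ _ → false) i ≡ 0ℤ
excess-∅ i = ∑ˢ-zero

-- Half of all subsets contain `i`, so the signs cancel.
excess-𝒫 : ∀ {n} (i : Fin n) → excess (λ _ → true) i ≡ 0ℤ
excess-𝒫 {suc n} zero = trans (∑ˢ-∷ {n} _) (trans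
  (sym (∑ˢ-+ {n} (λ _ → -1ℤ) (λ _ → 1ℤ))) ∑ˢ-zero)
excess-𝒫 {suc n} (suc i) = trans (∑ˢ-∷ {n} _) (cong₂ _+_ (excess-𝒫 i) (excess-𝒫 i))

-- The fibre over the top is 𝒫([n]), which has excess 0, the fibre over the
-- j-th coatom is the j-th family, and all others are empty.  Two distinct
-- coatoms join to the top, so the listed families need no common closure.
stack : ∀ {n} (𝓑s : List (Family n)) → Subset (length 𝓑s) → Family n
stack List.[]        []            S = true
stack (𝓑 List.∷ 𝓑s) (inside  ∷ t) S = stack 𝓑s t S
stack (𝓑 List.∷ 𝓑s) (outside ∷ t) S = isFull t ∧ 𝓑 S

stack-full : ∀ {n} (𝓑s : List (Family n)) t S → T (isFull t) → S ∈F stack 𝓑s t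
stack-full List.[]        []           S p = _
stack-full (𝓑 List.∷ 𝓑s) (inside ∷ t) S p = stack-full 𝓑s t S p

stack-closed : ∀ {n} {𝓑s : List (Family n)} → All Closed 𝓑s →
  ∀ t t′ S S′ → S ∈F stack 𝓑s t → S′ ∈F stack 𝓑s t′ → (S ∪ S′) ∈F stack 𝓑s (t ∪ t′)
stack-closed All.[] [] [] S S′ p p′ = _
stack-closed (c All.∷ cs) (inside ∷ t) (inside ∷ t′) S S′ p p′ = stack-closed cs t t′ S S′ p p′
-- Membership over an index with head `outside` forces its tail to be full. The join is then the
-- top, whose fibre contains every set.
stack-closed {𝓑s = 𝓑 List.∷ 𝓑s} (c All.∷ cs) (inside ∷ t) (outside ∷ t′) S S′ p p′ =
  stack-full 𝓑s (t ∪ t′) (S ∪ S′)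
    (subst (T ∘ isFull) (∪-comm t′ t) (isFull-∪ˡ t′ t (proj₁ (T-∧⁻ p′))))
stack-closed {𝓑s = 𝓑 List.∷ 𝓑s} (c All.∷ cs) (outside ∷ t) (inside ∷ t′) S S′ p p′ =
  stack-full 𝓑s (t ∪ t′) (S ∪ S′) (isFull-∪ˡ t t′ (proj₁ (T-∧⁻ p)))
stack-closed (c All.∷ cs) (outside ∷ t) (outside ∷ t′) S S′ p p′ =
  let f , s = T-∧⁻ p ; f′ , s′ = T-∧⁻ p′ in T-∧⁺ (isFull-∪ˡ t t′ f) (c S S′ s s′)

stack-absorbs : ∀ {n} {𝓐 : Family n} {𝓑s} → All (Absorbs 𝓐) 𝓑s → ∀ t → Absorbs 𝓐 (stack 𝓑s t)
stack-absorbs All.[]        []            S A a p = _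
stack-absorbs (b All.∷ bs) (inside  ∷ t) S A a p = stack-absorbs bs t S A a p
stack-absorbs (b All.∷ bs) (outside ∷ t) S A a p = let f , s = T-∧⁻ p in T-∧⁺ f (b S A a s)

excess-stack : ∀ {n} (𝓑s : List (Family n)) i →
  ∑ˢ (λ t → excess (stack 𝓑s t) i) ≡ sumℤ (List.map (λ 𝓑 → excess 𝓑 i) 𝓑s)
excess-stack List.[] i = trans (∑ˢ-[] (λ t → excess (stack List.[] t) i)) (excess-𝒫 i)
excess-stack (𝓑 List.∷ 𝓑s) i = trans (∑ˢ-∷ (λ t → excess (stack (𝓑 List.∷ 𝓑s) t) i)) (cong₂ _+_
  (∑ˢ-isFull (λ b → excess (λ S → b ∧ 𝓑 S) i) (excess-∅ i)) (excess-stack 𝓑s i))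

-- The extra coordinate keeps `𝓐`, over the empty subset, apart from the stack: for a list of length
-- 0 or 1 the empty subset would otherwise be the top or a coatom.
tower : ∀ {n} → Family n → (𝓑s : List (Family n)) → Subset (suc (length 𝓑s)) → Family n
tower 𝓐 𝓑s (outside ∷ t) S = isEmpty t ∧ 𝓐 S
tower 𝓐 𝓑s (inside  ∷ t) S = stack 𝓑s t S

-- Joining with the empty subset leaves the other index unchanged, so the mixed cases reduce to the
-- absorption of `𝓐` by the fibres of the stack.
tower-closed : ∀ {n} {𝓐 : Family n} {𝓑s} → Closed 𝓐 → All Closed 𝓑s → All (Absorbs 𝓐) 𝓑s →
  ∀ t t′ S S′ → S ∈F tower 𝓐 𝓑s t → S′ ∈F tower 𝓐 𝓑s t′ → (S ∪ S′) ∈F tower 𝓐 𝓑s (t ∪ t′)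
tower-closed c cs bs (inside ∷ t) (inside ∷ t′) S S′ p p′ = stack-closed cs t t′ S S′ p p′
tower-closed {𝓑s = 𝓑s} c cs bs (inside ∷ t) (outside ∷ t′) S S′ p p′ with T-∧⁻ p′
... | e′ , s′ with refl ← isEmpty⇒≡⊥ t′ e′ =
  subst₂ (λ u V → V ∈F stack 𝓑s u) (trans (sym (∪-identityˡ t)) (∪-comm ⊥ t)) (∪-comm S′ S)
    (stack-absorbs bs t S S′ s′ p)
tower-closed {𝓑s = 𝓑s} c cs bs (outside ∷ t) (inside ∷ t′) S S′ p p′ with T-∧⁻ p
... | e , s with refl ← isEmpty⇒≡⊥ t e =
  subst (λ u → (S ∪ S′) ∈F stack 𝓑s u) (sym (∪-identityˡ t′)) (stack-absorbs bs t′ S′ S s p′)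
tower-closed {𝓑s = 𝓑s} c cs bs (outside ∷ t) (outside ∷ t′) S S′ p p′ with T-∧⁻ p | T-∧⁻ p′
... | e , s | e′ , s′ with refl ← isEmpty⇒≡⊥ t e =
  T-∧⁺ (subst (T ∘ isEmpty) (sym (∪-identityˡ t′)) e′) (c S S′ s s′)

excess-tower : ∀ {n} (𝓐 : Family n) 𝓑s i →
  ∑ˢ (λ t → excess (tower 𝓐 𝓑s t) i) ≡ excess 𝓐 i + sumℤ (List.map (λ 𝓑 → excess 𝓑 i) 𝓑s)
excess-tower 𝓐 𝓑s i = trans (∑ˢ-∷ (λ t → excess (tower 𝓐 𝓑s t) i)) (cong₂ _+_
  (∑ˢ-isEmpty (λ b → excess (λ S → b ∧ 𝓐 S) i) (excess-∅ i)) (excess-stack 𝓑s i))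

copies : ∀ {A : Set} {k} → Vector ℕ k → Vector A k → List A
copies {k = zero}  l a = List.[]
copies {k = suc k} l a = replicate (l zero) (a zero) List.++ copies (l ∘ suc) (a ∘ suc)

copies⁺ : ∀ {A : Set} {P : A → Set} {k} (l : Vector ℕ k) (a : Vector A k) →
  (∀ j → P (a j)) → All P (copies l a)
copies⁺ {k = zero}  l a p = All.[]
copies⁺ {k = suc k} l a p = ++⁺ (replicate⁺ (l zero) (p zero)) (copies⁺ (l ∘ suc) (a ∘ suc) (p ∘ suc))

sumℤ-replicate : ∀ {A : Set} (f : A → ℤ) m x → sumℤ (List.map f (replicate m x)) ≡ + m * f x
sumℤ-replicate f zero    x = sym (*-zeroˡ (f x))
sumℤ-replicate f (suc m) x = trans (cong (λ z → f x + z) (sumℤ-replicate f m x)) (sym (suc-* (+ m) (f x)))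

sumℤ-copies : ∀ {A : Set} (f : A → ℤ) {k} (l : Vector ℕ k) (a : Vector A k) →
  sumℤ (List.map f (copies l a)) ≡ l ∙ (f ∘ a)
sumℤ-copies f {zero}  l a = sym (∑-[] (λ j → + l j * f (a j)))
sumℤ-copies f {suc k} l a = begin
  sumℤ (List.map f (xs List.++ ys))                 ≡⟨ cong sumℤ (map-++ f xs ys) ⟩
  sumℤ (List.map f xs List.++ List.map f ys)        ≡⟨ sumℤ-++ (List.map f xs) (List.map f ys) ⟩
  sumℤ (List.map f xs) + sumℤ (List.map f ys)
    ≡⟨ cong₂ _+_ (sumℤ-replicate f (l zero) (a zero)) (sumℤ-copies f (l ∘ suc) (a ∘ suc)) ⟩
  + l zero * f (a zero) + (l ∘ suc) ∙ (f ∘ a ∘ suc) ≡⟨ ∑-suc (λ j → + l j * f (a j)) ⟨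
  l ∙ (f ∘ a)                                       ∎
  where
  open ≡-Reasoning
  xs = replicate (l zero) (a zero)
  ys = copies (l ∘ suc) (a ∘ suc)

nonFC-of-combination : ∀ {n k} {𝓐 : Family n} → UnionClosed 𝓐 →
  (𝓑s : Vector (Family n) k) → (∀ j → Closed (𝓑s j)) → (∀ j → Absorbs 𝓐 (𝓑s j)) →
  (l : Vector ℕ k) → (∀ i → l ∙ (λ j → excess (𝓑s j) i) < 0ℤ) → IsNonFC 𝓐
nonFC-of-combination {n} {k} {𝓐} uc 𝓑s closed absorbs l neg =
  suc (length L) , 𝓕 ,
  record
    { nonempty = let S , a = UnionClosed.nonempty uc in S Vec.++ ⊥ , 𝓐⊑𝓕 S a
    ; closed   = glue-closed (tower 𝓐 L) (tower-closed (UnionClosed.closed uc)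
                   (copies⁺ K·l 𝓑s closed) (copies⁺ K·l 𝓑s absorbs))
    } ,
  𝓐⊑𝓕 ,
  λ i _ → excess<0⇒rare 𝓕 (i ↑ˡ suc (length L)) (rare i)
  where
  -- Enough copies to outweigh the excess of 𝓐 itself.
  K·l : Vector ℕ k
  K·l j = suc ∣ 𝓐 ∣F ℕ.* l j

  L = copies K·l 𝓑s
  𝓕 = glue n (tower 𝓐 L)

  𝓐⊑𝓕 : 𝓐 ⊑ 𝓕
  𝓐⊑𝓕 S a = subst T (sym (glue-++ (tower 𝓐 L) S ⊥)) (T-∧⁺ (isEmpty-⊥ (length L)) a)

  rare : ∀ i → excess 𝓕 (i ↑ˡ suc (length L)) < 0ℤ
  rare i = begin-strict
    excess 𝓕 (i ↑ˡ suc (length L))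
      ≡⟨ excess-fibre 𝓕 i ⟩
    ∑ˢ (λ t → excess (fibre 𝓕 t) i)
      ≡⟨ ∑ˢ-cong (λ t → excess-cong (λ S → glue-++ (tower 𝓐 L) S t) i) ⟩
    ∑ˢ (λ t → excess (tower 𝓐 L t) i)
      ≡⟨ excess-tower 𝓐 L i ⟩
    excess 𝓐 i + sumℤ (List.map (λ 𝓑 → excess 𝓑 i) L)
      ≡⟨ cong (λ z → excess 𝓐 i + z) (trans (sumℤ-copies (λ 𝓑 → excess 𝓑 i) K·l 𝓑s) (trans
           (∑-cong (λ j → trans (cong (_* d j) (pos-* (suc ∣ 𝓐 ∣F) (l j))) (*-assoc K (+ l j) (d j))))
           (sym (∑-*ˡ K (λ j → + l j * d j))))) ⟩
    excess 𝓐 i + K * l ∙ d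
      -- A negative integer is at most -1, and `K` exceeds `∣ 𝓐 ∣F` by one.
      ≤⟨ +-mono-≤ (excess≤∣∣F 𝓐 i) (*-monoˡ-≤-nonNeg K {l ∙ d} { -1ℤ } (i<j⇒i≤pred[j] (neg i))) ⟩
    + ∣ 𝓐 ∣F + K * -1ℤ
      ≡⟨ collapse (+ ∣ 𝓐 ∣F) ⟩
    -1ℤ
      <⟨ -<+ ⟩
    0ℤ ∎
    where
    open ≤-Reasoning
    K = +[1+ ∣ 𝓐 ∣F ]
    d = λ j → excess (𝓑s j) i
    collapse : ∀ a → a + (1ℤ + a) * -1ℤ ≡ -1ℤ
    collapse = solve-∀

-- Correctness and termination

-- By integrality `v i ≤ -1`, so the sum is at most minus the total of `c`.
∙-negative : ∀ {n} (c : Vector ℕ n) (v : Vector ℤ n) → 0ℤ < ∑ (+_ ∘ c) → (∀ i → v i < 0ℤ) → c ∙ v < 0ℤ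
∙-negative c v c>0 v<0 = begin-strict
  c ∙ v                      ≤⟨ ∑-mono (λ i → *-monoˡ-≤-nonNeg (+ c i) {v i} { -1ℤ } (i<j⇒i≤pred[j] (v<0 i))) ⟩
  ∑ (λ i → + c i * -1ℤ)      ≡⟨ ∑-cong (λ i → *-comm (+ c i) -1ℤ) ⟩
  ∑ (λ i → -1ℤ * + c i)      ≡⟨ ∑-*ˡ -1ℤ (+_ ∘ c) ⟨
  -1ℤ * ∑ (+_ ∘ c)           ≡⟨ -1*i≡-i (∑ (+_ ∘ c)) ⟩
  - ∑ (+_ ∘ c)               <⟨ neg-mono-< c>0 ⟩
  0ℤ                         ∎
  where open ≤-Reasoning

∙-swap : ∀ {n k} (c : Vector ℕ n) (l : Vector ℕ k) (v : Fin n → Fin k → ℤ) →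
  c ∙ (λ i → l ∙ v i) ≡ l ∙ (λ j → c ∙ (λ i → v i j))
∙-swap c l v = begin
  ∑ (λ i → + c i * ∑ (λ j → + l j * v i j))   ≡⟨ ∑-cong (λ i → ∑-*ˡ (+ c i) (λ j → + l j * v i j)) ⟩
  ∑ (λ i → ∑ (λ j → + c i * (+ l j * v i j))) ≡⟨ ∑-swap (λ i j → + c i * (+ l j * v i j)) ⟩
  ∑ (λ j → ∑ (λ i → + c i * (+ l j * v i j))) ≡⟨ ∑-cong (λ j → ∑-cong (λ i → exchange (+ c i) (+ l j) (v i j))) ⟩
  ∑ (λ j → ∑ (λ i → + l j * (+ c i * v i j))) ≡⟨ ∑-cong (λ j → ∑-*ˡ (+ l j) (λ i → + c i * v i j)) ⟨
  ∑ (λ j → + l j * ∑ (λ i → + c i * v i j))   ∎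
  where
  open ≡-Reasoning
  exchange : ∀ a b x → a * (b * x) ≡ b * (a * x)
  exchange = solve-∀

scaled-total : ∀ {n} {y : Vector ℚᵘ n} → simplex y → ∑ (+_ ∘ scaled y) ≡ + commonDenominator y
scaled-total {y = y} (∑y≃1 , y≥0) =
  total-scaled (commonDenominator y) {{commonDenominator-nonZero y}} y (scaled y) (scaled-scales y y≥0) ∑y≃1

scaled-positive : ∀ {n} {y : Vector ℚᵘ n} → simplex y → 0ℤ < ∑ (+_ ∘ scaled y)
scaled-positive {y = y} s = subst (0ℤ <_) (sym (scaled-total s))
  (+<+ (ℕ.>-nonZero⁻¹ (commonDenominator y) {{commonDenominator-nonZero y}}))

halfspace⇒scaled : ∀ {n} {y : Vector ℚᵘ n} 𝓑 → simplex y → halfspace 𝓑 y → 0ℤ ≤ scaled y ∙ excess 𝓑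
halfspace⇒scaled {y = y} 𝓑 s@(_ , y≥0) =
  excess-of-halfspace (commonDenominator y) {{commonDenominator-nonZero y}} y (scaled y)
    (scaled-scales y y≥0) (scaled-total s) 𝓑

scaled⇒halfspace : ∀ {n} {y : Vector ℚᵘ n} 𝓑 → simplex y → 0ℤ ≤ scaled y ∙ excess 𝓑 → halfspace 𝓑 y
scaled⇒halfspace {y = y} 𝓑 s@(_ , y≥0) =
  halfspace-of-excess (commonDenominator y) {{commonDenominator-nonZero y}} y (scaled y)
    (scaled-scales y y≥0) (scaled-total s) 𝓑

-- The point is `c` divided by its total. The total serves as the common denominator, so `c` itself
-- is the integer multiple of the point.
simplex-point : ∀ {n} (c : Vector ℕ n) → 0ℤ < ∑ (+_ ∘ c) →
  ∃ λ y → simplex y × (∀ 𝓑 → 0ℤ ≤ c ∙ excess 𝓑 → halfspace 𝓑 y)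
simplex-point c c>0 = normalise (∑ (+_ ∘ c)) refl c>0
  where
  normalise : ∀ s → ∑ (+_ ∘ c) ≡ s → 0ℤ < s →
    ∃ λ y → simplex y × (∀ 𝓑 → 0ℤ ≤ c ∙ excess 𝓑 → halfspace 𝓑 y)
  normalise +0 _ (+<+ ())
  -- `mkℚᵘ` takes the denominator minus one, hence the total in the form d + 1.
  normalise +[1+ d ] total _ = y ,
    (total-unscaled (suc d) y c (λ _ → refl) total ,
     λ i → *≤* (subst₂ _≤_ refl (sym (*-identityʳ (+ c i))) (+≤+ ℕ.z≤n))) ,
    halfspace-of-excess (suc d) y c (λ _ → refl) total
    where
    y : Vector ℚᵘ _
    y i = mkℚᵘ (+ c i) d

-- Unions keep the trace `t`: two members of the fibre give `t ∪ t = t`, and a member of `𝓐` with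
-- one of the fibre gives `⊥ ∪ t = t`.
fibre-admissible : ∀ {n m} {𝓐 : Family n} {𝓕 : Family (n ℕ.+ m)} → UnionClosed 𝓕 → 𝓐 ⊑ 𝓕 →
  ∀ {c} t → c ∙ excess (fibre 𝓕 t) < 0ℤ → Admissible 𝓐 c (fibre 𝓕 t)
fibre-admissible {𝓕 = 𝓕} uc 𝓐⊑𝓕 t neg =
  (λ S S′ p p′ → subst (_∈F 𝓕)
    (trans (zipWith-++ _ S t S′ t) (cong ((S ∪ S′) Vec.++_) (∪-idem t)))
    (closed (S Vec.++ t) (S′ Vec.++ t) p p′)) ,
  (λ S A a p → subst (_∈F 𝓕)
    (trans (zipWith-++ _ A ⊥ S t) (cong ((A ∪ S) Vec.++_) (∪-identityˡ t)))
    (closed (A Vec.++ ⊥) (S Vec.++ t) (𝓐⊑𝓕 A a) p)) ,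
  neg
  where open UnionClosed uc

FC-of-inadmissible : ∀ {n} {𝓐 : Family n} → (∀ i → i ∈U 𝓐) → ∀ c → 0ℤ < ∑ (+_ ∘ c) →
  (∀ 𝓑 → ¬ Admissible 𝓐 c 𝓑) → IsFC 𝓐
FC-of-inadmissible {n} {𝓐} full c c>0 none m 𝓕 uc 𝓐⊑𝓕
  -- Abundance at some `i` is decidable, so it suffices to refute that every `i` is rare.
  with any? (λ i → ∣ 𝓕 ∣F ℕ.≤? 2 ℕ.* ∣ 𝓕 at (i ↑ˡ m) ∣F)
... | yes (i , abundant) = i , full i , abundant
... | no  allRare = contradiction (fibre-admissible {𝓐 = 𝓐} {𝓕} uc 𝓐⊑𝓕 {c} t t<0) (none (fibre 𝓕 t))
  where
  excess<0 : ∀ i → excess 𝓕 (i ↑ˡ m) < 0ℤ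
  excess<0 i = rare⇒excess<0 𝓕 (i ↑ˡ m) (ℕ.≰⇒> (λ le → allRare (i , le)))

  sum-of-fibres : c ∙ (λ i → excess 𝓕 (i ↑ˡ m)) ≡ ∑ˢ (λ t → c ∙ excess (fibre 𝓕 t))
  sum-of-fibres = begin
    ∑ (λ i → + c i * excess 𝓕 (i ↑ˡ m))
      ≡⟨ ∑-cong (λ i → cong (+ c i *_) (excess-fibre 𝓕 i)) ⟩
    ∑ (λ i → + c i * ∑ˢ (λ t → excess (fibre 𝓕 t) i))
      ≡⟨ ∑-cong (λ i → ∑ˢ-*ˡ (+ c i) (λ t → excess (fibre 𝓕 t) i)) ⟨
    ∑ (λ i → ∑ˢ (λ t → + c i * excess (fibre 𝓕 t) i))
      ≡⟨ ∑ˢ-∑-swap (λ t i → + c i * excess (fibre 𝓕 t) i) ⟨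
    ∑ˢ (λ t → c ∙ excess (fibre 𝓕 t)) ∎
    where open ≡-Reasoning

  negative-fibre : ∃ λ t → c ∙ excess (fibre 𝓕 t) < 0ℤ
  negative-fibre = ∑ˢ-negative (λ t → c ∙ excess (fibre 𝓕 t))
    (subst (_< 0ℤ) sum-of-fibres (∙-negative c (λ i → excess 𝓕 (i ↑ˡ m)) c>0 excess<0))
  t = proj₁ negative-fibre
  t<0 = proj₂ negative-fibre

FC-NonFC-exclusive : ∀ {n} {𝓐 : Family n} → IsFC 𝓐 → ¬ IsNonFC 𝓐
FC-NonFC-exclusive fc (m , 𝓕 , uc , 𝓐⊑𝓕 , rare) =
  let i , i∈U , abundant = fc m 𝓕 uc 𝓐⊑𝓕 in ℕ.<⇒≱ (rare i i∈U) abundant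

halfspace-resp : ∀ {n} {𝓑 𝓒 : Family n} {y} → (∀ S → 𝓑 S ≡ 𝓒 S) →
  simplex y → halfspace 𝓑 y → halfspace 𝓒 y
halfspace-resp {𝓑 = 𝓑} {𝓒} {y} 𝓑≗𝓒 s h = scaled⇒halfspace 𝓒 s
  (subst (0ℤ ≤_) (∑-cong (λ i → cong (+ scaled y i *_) (excess-cong 𝓑≗𝓒 i))) (halfspace⇒scaled 𝓑 s h))

-- (WV) and the halfspace demand opposite signs of the same integer `scaled y ∙ excess 𝓑`.
cut-excludes : ∀ {n} {𝓐 : Family n} {y 𝓑} → simplex y → X 𝓐 (scaled y) (incidence 𝓑) → ¬ halfspace 𝓑 y
cut-excludes {𝓐 = 𝓐} {y} {𝓑} s x h =
  let _ , _ , neg = X⇒admissible {𝓐 = 𝓐} {c = scaled y} 𝓑 (λ _ → refl) x in <⇒≱ neg (halfspace⇒scaled 𝓑 s h)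

-- Loop invariant, progress and termination of the algorithm

module _ {n} {𝓐 : Family n} where
  open CuttingPlanes 𝓐

  -- The simplex cut by finitely many halfspaces, together with the properties (UC) and (FS) of
  -- their families, from which a non-FC witness can be built once `H` is empty.
  record Polyhedron (H : RationalPoints n) : Set where
    field
      k        : ℕ
      𝓑s       : Vector (Family n) k
      closed   : ∀ j → Closed (𝓑s j)
      absorbs  : ∀ j → Absorbs 𝓐 (𝓑s j)
      ⊆simplex : ∀ {y} → H y → simplex y
      ⊆cuts    : ∀ {y} → H y → ∀ j → halfspace (𝓑s j) y
      ⊇        : ∀ {y} → simplex y → (∀ j → halfspace (𝓑s j) y) → H y

  -- At a returned verdict the invariant is the correctness of that verdict.
  Invariant : State → Set
  Invariant (loop H)         = Polyhedron H
  Invariant (picked H ȳ)     = Polyhedron H × H ȳ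
  Invariant (returned FC)    = IsFC 𝓐
  Invariant (returned NonFC) = IsNonFC 𝓐

  invariant-start : Invariant start
  invariant-start = record
    { k = 0 ; 𝓑s = λ () ; closed = λ () ; absorbs = λ ()
    ; ⊆simplex = λ s → s ; ⊆cuts = λ _ () ; ⊇ = λ s _ → s }

  -- Ville's alternative for the excess vectors of the cuts: `c` normalises to a point of `H`,
  -- whereas `l` excludes all such points and also builds the non-FC witness.
  emptiness : UnionClosed 𝓐 → ∀ {H} → Polyhedron H → ∃ H ⊎ (¬ ∃ H × IsNonFC 𝓐)
  emptiness uc {H} P with ville (λ i j → excess (Polyhedron.𝓑s P j) i)
  ... | inj₁ (c , c>0 , c∙excess≥0) =
    let y , s , h = simplex-point c c>0 in inj₁ (y , ⊇ s (λ j → h (𝓑s j) (c∙excess≥0 j)))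
    where open Polyhedron P
  ... | inj₂ (l , l∙excess<0) = inj₂ (empty , nonFC-of-combination uc 𝓑s closed absorbs l l∙excess<0)
    where
    open Polyhedron P
    empty : ¬ ∃ H
    -- One double sum, taken in two orders, would be both negative and nonnegative.
    empty (y , Hy) = <⇒≱
      (subst (_< 0ℤ) (∙-swap (scaled y) l (λ i j → excess (𝓑s j) i))
        (∙-negative (scaled y) (λ i → l ∙ (λ j → excess (𝓑s j) i)) (scaled-positive (⊆simplex Hy)) l∙excess<0))
      (∑-nonNeg (λ j → *-nonNeg {+ l j} (+≤+ ℕ.z≤n) (halfspace⇒scaled (𝓑s j) (⊆simplex Hy) (⊆cuts Hy j))))

  invariant-step : UnionClosed 𝓐 → (∀ i → i ∈U 𝓐) → ∀ {s s′} → s ⟶ s′ → Invariant s → Invariant s′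
  invariant-step uc full (pick h) P = P , h
  invariant-step uc full (cut {H} {ȳ} 𝓑 x) (P , h) = record
    { k        = suc k
    ; 𝓑s       = 𝓑 Vector.∷ 𝓑s
    ; closed   = λ { zero → proj₁ adm ; (suc j) → closed j }
    ; absorbs  = λ { zero → proj₁ (proj₂ adm) ; (suc j) → absorbs j }
    ; ⊆simplex = λ (Hy , _) → ⊆simplex Hy
    ; ⊆cuts    = λ { (_ , h) zero → h ; (Hy , _) (suc j) → ⊆cuts Hy j }
    ; ⊇        = λ s hs → ⊇ s (hs ∘ suc) , hs zero
    }
    where
    open Polyhedron P
    adm = X⇒admissible {c = scaled ȳ} 𝓑 (λ _ → refl) x
  invariant-step uc full (stop {ȳ = ȳ} none) (P , h) =
    FC-of-inadmissible full (scaled ȳ) (scaled-positive (Polyhedron.⊆simplex P h))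
      (λ 𝓑 adm → none (incidence 𝓑) (admissible⇒X 𝓑 adm))
  invariant-step uc full (exhausted empty) P with emptiness uc P
  ... | inj₁ (y , Hy)    = contradiction Hy (empty y)
  ... | inj₂ (_ , nonFC) = nonFC

  invariant : UnionClosed 𝓐 → (∀ i → i ∈U 𝓐) → ∀ {s s′} → s ⟶* s′ → Invariant s → Invariant s′
  invariant uc full ε            I = I
  invariant uc full (st ◅ steps) I = invariant uc full steps (invariant-step uc full st I)

  -- Both conditions of the loop are decidable: emptiness of `H` by Ville's theorem, emptiness of
  -- X(𝓐,c) by search through all families.
  progress : UnionClosed 𝓐 → ∀ s → Invariant s → (∃ λ r → s ≡ returned r) ⊎ (∃ λ s′ → s ⟶ s′)
  progress uc (loop H) P with emptiness uc P
  ... | inj₁ (y , Hy)    = inj₂ (picked H y , pick Hy)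
  ... | inj₂ (empty , _) = inj₂ (returned NonFC , exhausted (λ y Hy → empty (y , Hy)))
  progress uc (picked H ȳ) _
    with anyFamily? (admissible-resp {𝓐 = 𝓐} {scaled ȳ}) (admissible? 𝓐 (scaled ȳ))
  ... | yes (𝓑 , adm) = inj₂ (_ , cut 𝓑 (admissible⇒X 𝓑 adm))
  -- Every point of X(𝓐,c) is the incidence vector of its support, so without an admissible family
  -- there is no point.
  ... | no  none      = inj₂ (_ , stop (λ x X-x →
    none (support x , X⇒admissible (support x) (support-incidence X-x) X-x)))
  progress uc (returned r) _ = inj₁ (r , refl)

  -- The invariant confirms the returned verdict, and exclusivity of FC and Non-FC rules out the
  -- other one.
  returned-correct : ∀ r → Invariant (returned r) → (r ≡ FC ⇔ IsFC 𝓐) × (r ≡ NonFC ⇔ IsNonFC 𝓐)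
  returned-correct FC    fc    = mk⇔ (λ _ → fc) (λ _ → refl) ,
    mk⇔ (λ ()) (λ nonFC → contradiction nonFC (FC-NonFC-exclusive fc))
  returned-correct NonFC nonFC = mk⇔ (λ ()) (λ fc → contradiction nonFC (FC-NonFC-exclusive fc)) ,
    mk⇔ (λ _ → nonFC) (λ _ → refl)

  -- A picked point violates the cut it leads to, so every cut uses up a new code.
  terminates : ∀ {unused} → Acc _⊂_ unused → ∀ {H} → (∀ {y} → H y → simplex y) →
    (∀ 𝓑 → encode 𝓑 ∉ unused → ∀ {y} → H y → halfspace 𝓑 y) → Acc (flip _⟶_) (loop H)
  terminates {unused} (acc rs) {H} ⊆simplex used = acc λ
    { (pick {ȳ = ȳ} h) → acc λ
      { (cut 𝓑 x) → terminates (rs (x∈p⇒p-x⊂p (fresh h 𝓑 x))) (λ (Hy , _) → ⊆simplex Hy) (used′ 𝓑)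
      ; (stop _)  → acc λ ()
      }
    ; (exhausted _) → acc λ ()
    }
    where
    -- If the code were used up, `H` would lie in the halfspace of `𝓑`, which the picked point
    -- violates.
    fresh : ∀ {ȳ} → H ȳ → ∀ 𝓑 → X 𝓐 (scaled ȳ) (incidence 𝓑) → encode 𝓑 ∈ unused
    fresh h 𝓑 x = decidable-stable (encode 𝓑 ∈? unused)
      (λ 𝓑-used → cut-excludes {𝓑 = 𝓑} (⊆simplex h) x (used 𝓑 𝓑-used h))

    used′ : ∀ 𝓑 𝓒 → encode 𝓒 ∉ unused Subset.- encode 𝓑 → ∀ {y} → H y × halfspace 𝓑 y → halfspace 𝓒 y
    used′ 𝓑 𝓒 ∉ (Hy , h) with encode 𝓑 Fin.≟ encode 𝓒
    -- Equal codes mean pointwise equal families, whose halfspaces agree on the simplex.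
    ... | yes eq = halfspace-resp (encode-injective eq) (⊆simplex Hy) h
    ... | no  ≢  = used 𝓒 (λ ∈unused → ∉ (x∈p∧x≢y⇒x∈p-y ∈unused (≢ ∘ sym))) Hy

theorem4 : (n : ℕ) → 1 ℕ.≤ n →
    (𝓐 : Family n) → UnionClosed 𝓐 → (∀ i → i ∈U 𝓐) → ⊥ ∈F 𝓐 →
    let open CuttingPlanes 𝓐 in
    Acc (flip _⟶_) start
    × (∀ s → start ⟶* s → (∃ λ r → s ≡ returned r) ⊎ (∃ λ s′ → s ⟶ s′))
    × (∀ r → start ⟶* returned r →
    (r ≡ FC ⇔ IsFC 𝓐) × (r ≡ NonFC ⇔ IsNonFC 𝓐))
theorem4 n _ 𝓐 uc full _ =
  terminates (⊂-wellFounded ⊤) (λ s → s) (λ 𝓑 ∉⊤ → contradiction ∈⊤ ∉⊤) ,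
  (λ s steps → progress uc s (invariant uc full steps invariant-start)) ,
  (λ r steps → returned-correct r (invariant uc full steps invariant-start))
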